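{- For the submodular maximization problem with an unknown knapsack capacity restricted to instances in which every item has size $1$, no deterministic policy achieves a robustness ratio better than $(1+\sqrt5)/4$, and no randomized policy achieves a robustness ratio better than $(5+\sqrt5)/8$. That is, for every $\alpha>(1+\sqrt5)/4$ there is an instance with only unit-size items for which no deterministic adaptive policy is $\alpha$-robust, and for every $\alpha>(5+\sqrt5)/8$ there is an instance with only unit-size items for which no randomized adaptive policy is $\alpha$-robust.
   Context: Submodular maximization problem with an unknown knapsack capacity: an instance is a finite set $I$ of items with positive integer sizes $s(i)$ and a monotone submodular function $f\colon 2^I\to\mathbb{R}_+$ with $f(\emptyset)=0$. The capacity $C$ is unknown. Items are tried one at a time, each at most once. When item $i$ is tried and the current knapsack content is $X$, we learn whether $s(X)+s(i)\le C$, where $s(X)=\sum_{j\in X}s(j)$. If so, $i$ is irrevocably added to $X$; otherwise $i$ is discarded, and the process continues with the remaining items (if cancellation is allowed) or stops (if not). When all sizes are $1$, once one item does not fit no other item fits, so the output does not depend on whether cancellation is allowed. A (deterministic) adaptive policy is a binary decision tree specifying the next item to try depending on the observations so far; a randomized policy is a probability distribution over such trees. No computational restriction is imposed on policies. Let $\mathrm{ALG}_C$ be the (possibly random) output when the capacity is $C$ and let $\mathrm{OPT}_C$ maximize $f(X)$ over $X\subseteq I$ with $s(X)\le C$. The policy is $\alpha$-robust if $\mathbb{E}[f(\mathrm{ALG}_C)]\ge\alpha f(\mathrm{OPT}_C)$ for every $C\in\mathbb{R}_+$. -}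

module Defs where

open import Data.Bool.Base using (if_then_else_)
open import Data.Fin.Base using (Fin)
open import Data.Fin.Subset using (Subset; ⊥; ⁅_⁆; _∪_; _∩_; _∉_; _⊆_)
open import Data.Integer.Base as ℤ using (+_)
import Data.Integer.Properties as ℤ
import Data.Integer.Solver as ℤ
open import Data.Nat.Base as ℕ using (ℕ; zero; suc)
import Data.Nat.Properties as ℕ
import Data.Nat.Solver as ℕ
open import Data.Product.Base using (∃; ∃-syntax; _×_; _,_; proj₁; proj₂)
open import Data.Rational.Base as ℚ using (ℚ; 0ℚ; 1ℚ; ½; ∣_∣)
import Data.Rational.Properties as ℚ
import Data.Rational.Solver as ℚ
import Data.Rational.Unnormalised.Base as ℚᵘ
import Data.Rational.Unnormalised.Properties as ℚᵘ
open import Data.Sum.Base using (inj₁; inj₂)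
open import Data.Vec.Base using (lookup; sum; tabulate)
open import Data.Vec.Functional using (foldr)
open import Relation.Binary.PropositionalEquality
  using (_≡_; refl; sym; trans; cong; cong₂; subst; subst₂)
open import Relation.Nullary.Decidable.Core using (yes; no)
open import Relation.Nullary.Negation.Core using (¬_)

Cauchy : (ℕ → ℚ) → Set
Cauchy x = ∀ ε → 0ℚ ℚ.< ε →
  ∃[ N ] ∀ {m n} → N ℕ.≤ m → N ℕ.≤ n → ∣ x m ℚ.- x n ∣ ℚ.< ε

-- The equality of reals is _≈_, not _≡_.
record ℝ : Set where
  constructor mkℝ
  field
    seq    : ℕ → ℚ
    cauchy : Cauchy seq

open ℝ public

infix 4 _≤_ _<_ _≈_

_≤_ : ℝ → ℝ → Set
x ≤ y = ∀ ε → 0ℚ ℚ.< ε → ∃[ N ] ∀ {n} → N ℕ.≤ n → seq x n ℚ.≤ seq y n ℚ.+ ε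

_<_ : ℝ → ℝ → Set
x < y = ∃[ ε ] 0ℚ ℚ.< ε × ∃[ N ] ∀ {n} → N ℕ.≤ n → seq x n ℚ.+ ε ℚ.≤ seq y n

_≈_ : ℝ → ℝ → Set
x ≈ y = x ≤ y × y ≤ x

private
  abstract
    const-cauchy : ∀ p → Cauchy (λ _ → p)
    const-cauchy p ε 0<ε = 0 , λ _ _ →
      subst (λ d → ∣ d ∣ ℚ.< ε) (sym (ℚ.+-inverseʳ p)) 0<ε

fromℚ : ℚ → ℝ
fromℚ p = mkℝ (λ _ → p) (const-cauchy p)

fromℕ : ℕ → ℝ
fromℕ n = fromℚ (+ n ℚ./ 1)

private
  0<half : ∀ {ε} → 0ℚ ℚ.< ε → 0ℚ ℚ.< ε ℚ.* ½
  0<half 0<ε = ℚ.*-monoˡ-<-pos ½ 0<ε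

  half+half : ∀ ε → ε ℚ.* ½ ℚ.+ ε ℚ.* ½ ≡ ε
  half+half ε = trans (sym (ℚ.*-distribˡ-+ ε ½ ½)) (ℚ.*-identityʳ ε)

  abstract
    +-cauchy : ∀ x y → Cauchy x → Cauchy y → Cauchy (λ n → x n ℚ.+ y n)
    +-cauchy x y cx cy ε 0<ε
      with M , hx ← cx (ε ℚ.* ½) (0<half 0<ε) | N , hy ← cy (ε ℚ.* ½) (0<half 0<ε)
      = M ℕ.⊔ N , λ {m} {n} M⊔N≤m M⊔N≤n → begin-strict
        ∣ (x m ℚ.+ y m) ℚ.- (x n ℚ.+ y n) ∣
          ≡⟨ cong ∣_∣ (rearrange (x m) (y m) (x n) (y n)) ⟩
        ∣ (x m ℚ.- x n) ℚ.+ (y m ℚ.- y n) ∣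
          ≤⟨ ℚ.∣p+q∣≤∣p∣+∣q∣ (x m ℚ.- x n) (y m ℚ.- y n) ⟩
        ∣ x m ℚ.- x n ∣ ℚ.+ ∣ y m ℚ.- y n ∣
          <⟨ ℚ.+-mono-< (hx (ℕ.m⊔n≤o⇒m≤o M N M⊔N≤m) (ℕ.m⊔n≤o⇒m≤o M N M⊔N≤n))
                        (hy (ℕ.m⊔n≤o⇒n≤o M N M⊔N≤m) (ℕ.m⊔n≤o⇒n≤o M N M⊔N≤n)) ⟩
        ε ℚ.* ½ ℚ.+ ε ℚ.* ½
          ≡⟨ half+half ε ⟩
        ε ∎
      where
      open ℚ.≤-Reasoning
      open ℚ.+-*-Solver
      rearrange : ∀ a b c d → (a ℚ.+ b) ℚ.- (c ℚ.+ d) ≡ (a ℚ.- c) ℚ.+ (b ℚ.- d)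
      rearrange = solve 4 (λ a b c d → (a :+ b) :- (c :+ d) := (a :- c) :+ (b :- d)) refl

  eventually-bounded : ∀ {x} → Cauchy x →
    ∃[ B ] 0ℚ ℚ.< B × ∃[ N ] ∀ {n} → N ℕ.≤ n → ∣ x n ∣ ℚ.≤ B
  eventually-bounded {x} cx with N , h ← cx 1ℚ (ℚ.positive⁻¹ 1ℚ)
    = ∣ x N ∣ ℚ.+ 1ℚ
    , ℚ.+-mono-≤-< (ℚ.0≤∣p∣ (x N)) (ℚ.positive⁻¹ 1ℚ)
    , N
    , λ {n} N≤n → begin
      ∣ x n ∣                      ≡⟨ cong ∣_∣ (split (x N) (x n)) ⟩
      ∣ x N ℚ.+ (x n ℚ.- x N) ∣    ≤⟨ ℚ.∣p+q∣≤∣p∣+∣q∣ (x N) (x n ℚ.- x N) ⟩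
      ∣ x N ∣ ℚ.+ ∣ x n ℚ.- x N ∣  ≤⟨ ℚ.+-monoʳ-≤ ∣ x N ∣ (ℚ.<⇒≤ (h N≤n ℕ.≤-refl)) ⟩
      ∣ x N ∣ ℚ.+ 1ℚ               ∎
    where
    open ℚ.≤-Reasoning
    open ℚ.+-*-Solver
    split : ∀ a b → b ≡ a ℚ.+ (b ℚ.- a)
    split = solve 2 (λ a b → b := a :+ (b :- a)) refl

  *-mono-≤-< : ∀ {a b c d} → 0ℚ ℚ.≤ c → 0ℚ ℚ.< b → a ℚ.≤ b → c ℚ.< d →
               a ℚ.* c ℚ.< b ℚ.* d
  *-mono-≤-< {_} {b} {c} 0≤c 0<b a≤b c<d = ℚ.≤-<-trans
    (ℚ.*-monoʳ-≤-nonNeg c {{ℚ.nonNegative 0≤c}} a≤b)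
    (ℚ.*-monoʳ-<-pos b {{ℚ.positive 0<b}} c<d)

  scale : ∀ {A ε} → 0ℚ ℚ.< A → 0ℚ ℚ.< ε → ∃[ δ ] 0ℚ ℚ.< δ × A ℚ.* δ ≡ ε
  scale {A} {ε} 0<A 0<ε = A⁻¹ ℚ.* ε , 0<δ ,
    trans (sym (ℚ.*-assoc A A⁻¹ ε))
      (trans (cong (ℚ._* ε) (ℚ.*-inverseʳ A {{A≢0}})) (ℚ.*-identityˡ ε))
    where
    A-pos : ℚ.Positive A
    A-pos = ℚ.positive 0<A
    A≢0 : ℚ.NonZero A
    A≢0 = ℚ.pos⇒nonZero A {{A-pos}}
    A⁻¹ : ℚ
    A⁻¹ = (ℚ.1/ A) {{A≢0}}
    0<δ : 0ℚ ℚ.< A⁻¹ ℚ.* ε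
    0<δ = subst (ℚ._< A⁻¹ ℚ.* ε) (ℚ.*-zeroʳ A⁻¹)
            (ℚ.*-monoʳ-<-pos A⁻¹ {{ℚ.1/pos⇒pos A {{A-pos}}}} 0<ε)

  *-close : ∀ a b c d {A B δ} → 0ℚ ℚ.< A → 0ℚ ℚ.< B → ∣ a ∣ ℚ.≤ A → ∣ d ∣ ℚ.≤ B →
            ∣ a ℚ.- c ∣ ℚ.< δ → ∣ b ℚ.- d ∣ ℚ.< δ →
            ∣ a ℚ.* b ℚ.- c ℚ.* d ∣ ℚ.< (A ℚ.+ B) ℚ.* δ
  *-close a b c d {A} {B} {δ} 0<A 0<B ∣a∣≤A ∣d∣≤B a~c b~d = begin-strict
    ∣ a ℚ.* b ℚ.- c ℚ.* d ∣
      ≡⟨ cong ∣_∣ (rearrange a b c d) ⟩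
    ∣ a ℚ.* (b ℚ.- d) ℚ.+ d ℚ.* (a ℚ.- c) ∣
      ≤⟨ ℚ.∣p+q∣≤∣p∣+∣q∣ (a ℚ.* (b ℚ.- d)) (d ℚ.* (a ℚ.- c)) ⟩
    ∣ a ℚ.* (b ℚ.- d) ∣ ℚ.+ ∣ d ℚ.* (a ℚ.- c) ∣
      ≡⟨ cong₂ ℚ._+_ (ℚ.∣p*q∣≡∣p∣*∣q∣ a (b ℚ.- d)) (ℚ.∣p*q∣≡∣p∣*∣q∣ d (a ℚ.- c)) ⟩
    ∣ a ∣ ℚ.* ∣ b ℚ.- d ∣ ℚ.+ ∣ d ∣ ℚ.* ∣ a ℚ.- c ∣
      <⟨ ℚ.+-mono-< (*-mono-≤-< (ℚ.0≤∣p∣ (b ℚ.- d)) 0<A ∣a∣≤A b~d)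
                    (*-mono-≤-< (ℚ.0≤∣p∣ (a ℚ.- c)) 0<B ∣d∣≤B a~c) ⟩
    A ℚ.* δ ℚ.+ B ℚ.* δ
      ≡⟨ sym (ℚ.*-distribʳ-+ δ A B) ⟩
    (A ℚ.+ B) ℚ.* δ ∎
    where
    open ℚ.≤-Reasoning
    open ℚ.+-*-Solver
    rearrange : ∀ a b c d →
      a ℚ.* b ℚ.- c ℚ.* d ≡ a ℚ.* (b ℚ.- d) ℚ.+ d ℚ.* (a ℚ.- c)
    rearrange = solve 4 (λ a b c d →
      a :* b :- c :* d := a :* (b :- d) :+ d :* (a :- c)) refl

  abstract
    *-cauchy : ∀ x y → Cauchy x → Cauchy y → Cauchy (λ n → x n ℚ.* y n)
    *-cauchy x y cx cy ε 0<ε =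
      let
        A , 0<A , K , ∣x∣≤A = eventually-bounded cx
        B , 0<B , L , ∣y∣≤B = eventually-bounded cy
        δ , 0<δ , [A+B]δ≡ε = scale (ℚ.+-mono-< 0<A 0<B) 0<ε
        M , hx = cx δ 0<δ
        N , hy = cy δ 0<δ
        left  = ℕ.m⊔n≤o⇒m≤o
        right = ℕ.m⊔n≤o⇒n≤o
      in (K ℕ.⊔ L) ℕ.⊔ (M ℕ.⊔ N) , λ {m} {n} ≤m ≤n →
        subst (∣ x m ℚ.* y m ℚ.- x n ℚ.* y n ∣ ℚ.<_) [A+B]δ≡ε
          (*-close (x m) (y m) (x n) (y n) 0<A 0<B
            (∣x∣≤A (left K L (left (K ℕ.⊔ L) (M ℕ.⊔ N) ≤m)))
            (∣y∣≤B (right K L (left (K ℕ.⊔ L) (M ℕ.⊔ N) ≤n)))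
            (hx (left M N (right (K ℕ.⊔ L) (M ℕ.⊔ N) ≤m))
                (left M N (right (K ℕ.⊔ L) (M ℕ.⊔ N) ≤n)))
            (hy (right M N (right (K ℕ.⊔ L) (M ℕ.⊔ N) ≤m))
                (right M N (right (K ℕ.⊔ L) (M ℕ.⊔ N) ≤n))))

infixl 6 _+_
infixl 7 _*_ _/_

_+_ : ℝ → ℝ → ℝ
x + y = mkℝ (λ n → seq x n ℚ.+ seq y n) (+-cauchy (seq x) (seq y) (cauchy x) (cauchy y))

_*_ : ℝ → ℝ → ℝ
x * y = mkℝ (λ n → seq x n ℚ.* seq y n) (*-cauchy (seq x) (seq y) (cauchy x) (cauchy y))

_/_ : ℝ → (d : ℕ) → .{{ℕ.NonZero d}} → ℝ
x / d = x * fromℚ (+ 1 ℚ./ d)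

∑ : ∀ {k} → (Fin k → ℝ) → ℝ
∑ = foldr _+_ (fromℕ 0)

⌊√_⌋ : ℕ → ℕ
⌊√ zero ⌋  = zero
⌊√ suc m ⌋ with suc ⌊√ m ⌋ ℕ.* suc ⌊√ m ⌋ ℕ.≤? suc m
... | yes _ = suc ⌊√ m ⌋
... | no  _ = ⌊√ m ⌋

⌊√⌋-lower : ∀ m → ⌊√ m ⌋ ℕ.* ⌊√ m ⌋ ℕ.≤ m
⌊√⌋-lower zero = ℕ.z≤n
⌊√⌋-lower (suc m) with suc ⌊√ m ⌋ ℕ.* suc ⌊√ m ⌋ ℕ.≤? suc m
... | yes p = p
... | no  _ = ℕ.m≤n⇒m≤1+n (⌊√⌋-lower m)

⌊√⌋-upper : ∀ m → m ℕ.< suc ⌊√ m ⌋ ℕ.* suc ⌊√ m ⌋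
⌊√⌋-upper zero = ℕ.s≤s ℕ.z≤n
⌊√⌋-upper (suc m) with suc ⌊√ m ⌋ ℕ.* suc ⌊√ m ⌋ ℕ.≤? suc m
... | yes p = ℕ.≤-<-trans (⌊√⌋-upper m)
                (ℕ.*-mono-< (ℕ.n<1+n (suc ⌊√ m ⌋)) (ℕ.n<1+n (suc ⌊√ m ⌋)))
... | no ¬p = ℕ.≰⇒> ¬p

-- The largest multiple of 1/(n+1) whose square is at most a.
√seq : ℕ → ℕ → ℚ
√seq a n = + ⌊√ a ℕ.* (suc n ℕ.* suc n) ⌋ ℚ./ suc n

private
  /-mono : ∀ k l m n → k ℕ.* suc n ℕ.≤ l ℕ.* suc m → + k ℚ./ suc m ℚ.≤ + l ℚ./ suc n
  /-mono k l m n h = ℚ.toℚᵘ-cancel-≤ (begin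
    ℚ.toℚᵘ (+ k ℚ./ suc m)  ≃⟨ ℚ.toℚᵘ-fromℚᵘ (ℚᵘ.mkℚᵘ (+ k) m) ⟩
    ℚᵘ.mkℚᵘ (+ k) m         ≤⟨ ℚᵘ.*≤* (subst₂ ℤ._≤_ (ℤ.pos-* k (suc n)) (ℤ.pos-* l (suc m)) (ℤ.+≤+ h)) ⟩
    ℚᵘ.mkℚᵘ (+ l) n         ≃⟨ ℚᵘ.≃-sym (ℚ.toℚᵘ-fromℚᵘ (ℚᵘ.mkℚᵘ (+ l) n)) ⟩
    ℚ.toℚᵘ (+ l ℚ./ suc n)  ∎)
    where open ℚᵘ.≤-Reasoning

  /-suc : ∀ k n → + suc k ℚ./ suc n ≡ + k ℚ./ suc n ℚ.+ + 1 ℚ./ suc n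
  /-suc k n = ℚ.toℚᵘ-injective (begin
    ℚ.toℚᵘ (+ suc k ℚ./ suc n)
      ≈⟨ ℚ.toℚᵘ-fromℚᵘ (ℚᵘ.mkℚᵘ (+ suc k) n) ⟩
    ℚᵘ.mkℚᵘ (+ suc k) n
      ≈⟨ ℚᵘ.*≡* (trans (cong (+ suc k ℤ.*_) (ℤ.pos-* (suc n) (suc n))) (arith (+ k) (+ suc n))) ⟩
    ℚᵘ.mkℚᵘ (+ k) n ℚᵘ.+ ℚᵘ.mkℚᵘ (+ 1) n
      ≈⟨ ℚᵘ.+-cong (ℚᵘ.≃-sym (ℚ.toℚᵘ-fromℚᵘ (ℚᵘ.mkℚᵘ (+ k) n)))
                   (ℚᵘ.≃-sym (ℚ.toℚᵘ-fromℚᵘ (ℚᵘ.mkℚᵘ (+ 1) n))) ⟩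
    ℚ.toℚᵘ (+ k ℚ./ suc n) ℚᵘ.+ ℚ.toℚᵘ (+ 1 ℚ./ suc n)
      ≈⟨ ℚᵘ.≃-sym (ℚ.toℚᵘ-homo-+ (+ k ℚ./ suc n) (+ 1 ℚ./ suc n)) ⟩
    ℚ.toℚᵘ (+ k ℚ./ suc n ℚ.+ + 1 ℚ./ suc n) ∎)
    where
    open import Relation.Binary.Reasoning.Setoid ℚᵘ.≃-setoid
    open ℤ.+-*-Solver
    arith : ∀ k d → (+ 1 ℤ.+ k) ℤ.* (d ℤ.* d) ≡ (k ℤ.* d ℤ.+ + 1 ℤ.* d) ℤ.* d
    arith = solve 2 (λ k d → (con (+ 1) :+ k) :* (d :* d) := (k :* d :+ con (+ 1) :* d) :* d) refl

  /-*-/ : ∀ k l n → + k ℚ./ suc n ℚ.* (+ l ℚ./ suc n) ≡ + (k ℕ.* l) ℚ./ (suc n ℕ.* suc n)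
  /-*-/ k l n = ℚ.toℚᵘ-injective (begin
    ℚ.toℚᵘ (+ k ℚ./ suc n ℚ.* (+ l ℚ./ suc n))
      ≈⟨ ℚ.toℚᵘ-homo-* (+ k ℚ./ suc n) (+ l ℚ./ suc n) ⟩
    ℚ.toℚᵘ (+ k ℚ./ suc n) ℚᵘ.* ℚ.toℚᵘ (+ l ℚ./ suc n)
      ≈⟨ ℚᵘ.*-cong (ℚ.toℚᵘ-fromℚᵘ (ℚᵘ.mkℚᵘ (+ k) n)) (ℚ.toℚᵘ-fromℚᵘ (ℚᵘ.mkℚᵘ (+ l) n)) ⟩
    ℚᵘ.mkℚᵘ (+ k) n ℚᵘ.* ℚᵘ.mkℚᵘ (+ l) n
      ≈⟨ ℚᵘ.*≡* (cong (ℤ._* + (suc n ℕ.* suc n)) (sym (ℤ.pos-* k l))) ⟩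
    ℚᵘ.mkℚᵘ (+ (k ℕ.* l)) (n ℕ.+ n ℕ.* suc n)
      ≈⟨ ℚᵘ.≃-sym (ℚ.toℚᵘ-fromℚᵘ (ℚᵘ.mkℚᵘ (+ (k ℕ.* l)) (n ℕ.+ n ℕ.* suc n))) ⟩
    ℚ.toℚᵘ (+ (k ℕ.* l) ℚ./ (suc n ℕ.* suc n)) ∎)
    where open import Relation.Binary.Reasoning.Setoid ℚᵘ.≃-setoid

  1/-small : ∀ ε → 0ℚ ℚ.< ε → ∃[ N ] ∀ {n} → N ℕ.≤ n → + 1 ℚ./ suc n ℚ.< ε
  1/-small ε 0<ε = go ε (ℚ.positive 0<ε)
    where
    open ℚᵘ.≤-Reasoning
    go : ∀ ε → ℚ.Positive ε → ∃[ N ] ∀ {n} → N ℕ.≤ n → + 1 ℚ./ suc n ℚ.< ε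
    go ε@(ℚ.mkℚ ℤ.+[1+ p ] d _) _ = suc d , λ {n} d<n → ℚ.toℚᵘ-cancel-< (begin-strict
      ℚ.toℚᵘ (+ 1 ℚ./ suc n)  ≃⟨ ℚ.toℚᵘ-fromℚᵘ (ℚᵘ.mkℚᵘ (+ 1) n) ⟩
      ℚᵘ.mkℚᵘ (+ 1) n         <⟨ ℚᵘ.*<* (ℤ.+<+ (ℕ.<-≤-trans
                                   (subst (ℕ._< suc n) (sym (ℕ.*-identityˡ (suc d))) (ℕ.s≤s d<n))
                                   (ℕ.m≤n*m (suc n) (suc p)))) ⟩
      ℚ.toℚᵘ ε                ∎)

  square-cancel-≤ : ∀ {u v} → u ℕ.* u ℕ.≤ v ℕ.* v → u ℕ.≤ v
  square-cancel-≤ {u} {v} h = ℕ.≮⇒≥ λ v<u → ℕ.<⇒≱ (ℕ.*-mono-< v<u v<u) h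

  √seq-step : ∀ a m n → √seq a m ℚ.≤ √seq a n ℚ.+ + 1 ℚ./ suc n
  √seq-step a m n = subst (√seq a m ℚ.≤_) (/-suc l n)
    (/-mono k (suc l) m n (square-cancel-≤ (begin
      (k ℕ.* suc n) ℕ.* (k ℕ.* suc n)
        ≡⟨ interchange k (suc n) ⟩
      (k ℕ.* k) ℕ.* (suc n ℕ.* suc n)
        ≤⟨ ℕ.*-monoˡ-≤ (suc n ℕ.* suc n) (⌊√⌋-lower (a ℕ.* (suc m ℕ.* suc m))) ⟩
      a ℕ.* (suc m ℕ.* suc m) ℕ.* (suc n ℕ.* suc n)
        ≡⟨ swap a (suc m ℕ.* suc m) (suc n ℕ.* suc n) ⟩
      a ℕ.* (suc n ℕ.* suc n) ℕ.* (suc m ℕ.* suc m)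
        ≤⟨ ℕ.*-monoˡ-≤ (suc m ℕ.* suc m) (ℕ.<⇒≤ (⌊√⌋-upper (a ℕ.* (suc n ℕ.* suc n)))) ⟩
      (suc l ℕ.* suc l) ℕ.* (suc m ℕ.* suc m)
        ≡⟨ sym (interchange (suc l) (suc m)) ⟩
      (suc l ℕ.* suc m) ℕ.* (suc l ℕ.* suc m) ∎)))
    where
    open ℕ.≤-Reasoning
    open ℕ.+-*-Solver
    k = ⌊√ a ℕ.* (suc m ℕ.* suc m) ⌋
    l = ⌊√ a ℕ.* (suc n ℕ.* suc n) ⌋
    interchange : ∀ x y → (x ℕ.* y) ℕ.* (x ℕ.* y) ≡ (x ℕ.* x) ℕ.* (y ℕ.* y)
    interchange = solve 2 (λ x y → (x :* y) :* (x :* y) := (x :* x) :* (y :* y)) refl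
    swap : ∀ x y z → x ℕ.* y ℕ.* z ≡ x ℕ.* z ℕ.* y
    swap = solve 3 (λ x y z → x :* y :* z := x :* z :* y) refl

  ∣-∣-< : ∀ p q {γ δ ε} → p ℚ.≤ q ℚ.+ γ → q ℚ.≤ p ℚ.+ δ → γ ℚ.< ε → δ ℚ.< ε →
          ∣ p ℚ.- q ∣ ℚ.< ε
  ∣-∣-< p q {γ} {δ} {ε} p≤q+γ q≤p+δ γ<ε δ<ε with ℚ.∣p∣≡p∨∣p∣≡-p (p ℚ.- q)
  ... | inj₁ eq = subst (ℚ._< ε) (sym eq) (begin-strict
    p ℚ.- q            ≤⟨ ℚ.+-monoˡ-≤ (ℚ.- q) p≤q+γ ⟩
    (q ℚ.+ γ) ℚ.- q    ≡⟨ cancel q γ ⟩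
    γ                  <⟨ γ<ε ⟩
    ε                  ∎)
    where
    open ℚ.≤-Reasoning
    open ℚ.+-*-Solver
    cancel : ∀ x y → (x ℚ.+ y) ℚ.- x ≡ y
    cancel = solve 2 (λ x y → (x :+ y) :- x := y) refl
  ... | inj₂ eq = subst (ℚ._< ε) (sym eq) (begin-strict
    ℚ.- (p ℚ.- q)      ≡⟨ flip p q ⟩
    q ℚ.- p            ≤⟨ ℚ.+-monoˡ-≤ (ℚ.- p) q≤p+δ ⟩
    (p ℚ.+ δ) ℚ.- p    ≡⟨ cancel p δ ⟩
    δ                  <⟨ δ<ε ⟩
    ε                  ∎)
    where
    open ℚ.≤-Reasoning
    open ℚ.+-*-Solver
    cancel : ∀ x y → (x ℚ.+ y) ℚ.- x ≡ y
    cancel = solve 2 (λ x y → (x :+ y) :- x := y) refl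
    flip : ∀ x y → ℚ.- (x ℚ.- y) ≡ y ℚ.- x
    flip = solve 2 (λ x y → :- (x :- y) := y :- x) refl

  abstract
    √-cauchy : ∀ a → Cauchy (√seq a)
    √-cauchy a ε 0<ε =
      let N , small = 1/-small ε 0<ε
      in N , λ {m} {n} N≤m N≤n →
        ∣-∣-< (√seq a m) (√seq a n) (√seq-step a m n) (√seq-step a n m) (small N≤n) (small N≤m)

√ : ℕ → ℝ
√ a = mkℝ (√seq a) (√-cauchy a)

private
  √seq-nonneg : ∀ a n → 0ℚ ℚ.≤ √seq a n
  √seq-nonneg a n = /-mono 0 ⌊√ a ℕ.* (suc n ℕ.* suc n) ⌋ 0 n ℕ.z≤n

  √seq-lower : ∀ a n → √seq a n ℚ.* √seq a n ℚ.≤ + a ℚ./ 1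
  √seq-lower a n = subst (ℚ._≤ + a ℚ./ 1) (sym (/-*-/ k k n))
    (/-mono (k ℕ.* k) a (n ℕ.+ n ℕ.* suc n) 0
      (subst (ℕ._≤ a ℕ.* (suc n ℕ.* suc n)) (sym (ℕ.*-identityʳ (k ℕ.* k)))
        (⌊√⌋-lower (a ℕ.* (suc n ℕ.* suc n)))))
    where k = ⌊√ a ℕ.* (suc n ℕ.* suc n) ⌋

  √seq-upper : ∀ a n → + a ℚ./ 1 ℚ.≤
               (√seq a n ℚ.+ + 1 ℚ./ suc n) ℚ.* (√seq a n ℚ.+ + 1 ℚ./ suc n)
  √seq-upper a n = subst (+ a ℚ./ 1 ℚ.≤_)
    (trans (sym (/-*-/ (suc k) (suc k) n)) (cong₂ ℚ._*_ (/-suc k n) (/-suc k n)))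
    (/-mono a (suc k ℕ.* suc k) 0 (n ℕ.+ n ℕ.* suc n)
      (subst (a ℕ.* (suc n ℕ.* suc n) ℕ.≤_) (sym (ℕ.*-identityʳ (suc k ℕ.* suc k)))
        (ℕ.<⇒≤ (⌊√⌋-upper (a ℕ.* (suc n ℕ.* suc n))))))
    where k = ⌊√ a ℕ.* (suc n ℕ.* suc n) ⌋

  square-step : ∀ x δ {B} → x ℚ.≤ B → 0ℚ ℚ.≤ δ → δ ℚ.≤ 1ℚ →
                (x ℚ.+ δ) ℚ.* (x ℚ.+ δ) ℚ.≤ x ℚ.* x ℚ.+ (B ℚ.+ B ℚ.+ 1ℚ) ℚ.* δ
  square-step x δ {B} x≤B 0≤δ δ≤1 = begin
    (x ℚ.+ δ) ℚ.* (x ℚ.+ δ)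
      ≡⟨ expand x δ ⟩
    x ℚ.* x ℚ.+ (x ℚ.+ x ℚ.+ δ) ℚ.* δ
      ≤⟨ ℚ.+-monoʳ-≤ (x ℚ.* x) (ℚ.*-monoʳ-≤-nonNeg δ {{ℚ.nonNegative 0≤δ}}
           (ℚ.+-mono-≤ (ℚ.+-mono-≤ x≤B x≤B) δ≤1)) ⟩
    x ℚ.* x ℚ.+ (B ℚ.+ B ℚ.+ 1ℚ) ℚ.* δ ∎
    where
    open ℚ.≤-Reasoning
    open ℚ.+-*-Solver
    expand : ∀ x δ → (x ℚ.+ δ) ℚ.* (x ℚ.+ δ) ≡ x ℚ.* x ℚ.+ (x ℚ.+ x ℚ.+ δ) ℚ.* δ
    expand = solve 2 (λ x δ → (x :+ δ) :* (x :+ δ) := x :* x :+ (x :+ x :+ δ) :* δ) refl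

  p≤p+ε : ∀ p {ε} → 0ℚ ℚ.< ε → p ℚ.≤ p ℚ.+ ε
  p≤p+ε p {ε} 0<ε = subst (ℚ._≤ p ℚ.+ ε) (ℚ.+-identityʳ p) (ℚ.+-monoʳ-≤ p (ℚ.<⇒≤ 0<ε))

  0<2B+1 : ∀ {B} → 0ℚ ℚ.< B → 0ℚ ℚ.< B ℚ.+ B ℚ.+ 1ℚ
  0<2B+1 {B} 0<B = ℚ.+-mono-< {0ℚ} {B ℚ.+ B} {0ℚ} {1ℚ}
    (ℚ.+-mono-< {0ℚ} {B} {0ℚ} {B} 0<B 0<B) (ℚ.positive⁻¹ 1ℚ)

√-nonneg : ∀ a → fromℕ 0 ≤ √ a
√-nonneg a ε 0<ε = 0 , λ {n} _ → ℚ.≤-trans (√seq-nonneg a n) (p≤p+ε (√seq a n) 0<ε)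

√-square : ∀ a → √ a * √ a ≈ fromℕ a
√-square a = below , above
  where
  below : √ a * √ a ≤ fromℕ a
  below ε 0<ε = 0 , λ {n} _ →
    ℚ.≤-trans {√seq a n ℚ.* √seq a n} {+ a ℚ./ 1} {+ a ℚ./ 1 ℚ.+ ε}
      (√seq-lower a n) (p≤p+ε (+ a ℚ./ 1) 0<ε)

  close : ∀ x γ {B δ} → + a ℚ./ 1 ℚ.≤ (x ℚ.+ γ) ℚ.* (x ℚ.+ γ) →
          0ℚ ℚ.< B → ∣ x ∣ ℚ.≤ B → 0ℚ ℚ.≤ x → 0ℚ ℚ.≤ γ → γ ℚ.≤ 1ℚ → γ ℚ.≤ δ →
          + a ℚ./ 1 ℚ.≤ x ℚ.* x ℚ.+ (B ℚ.+ B ℚ.+ 1ℚ) ℚ.* δ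
  close x γ {B} {δ} a≤ 0<B ∣x∣≤B 0≤x 0≤γ γ≤1 γ≤δ = begin
    + a ℚ./ 1
      ≤⟨ a≤ ⟩
    (x ℚ.+ γ) ℚ.* (x ℚ.+ γ)
      ≤⟨ square-step x γ (subst (ℚ._≤ B) (ℚ.0≤p⇒∣p∣≡p 0≤x) ∣x∣≤B) 0≤γ γ≤1 ⟩
    x ℚ.* x ℚ.+ (B ℚ.+ B ℚ.+ 1ℚ) ℚ.* γ
      ≤⟨ ℚ.+-monoʳ-≤ (x ℚ.* x) (ℚ.*-monoˡ-≤-nonNeg (B ℚ.+ B ℚ.+ 1ℚ)
           {{ℚ.nonNegative (ℚ.<⇒≤ (0<2B+1 0<B))}} γ≤δ) ⟩
    x ℚ.* x ℚ.+ (B ℚ.+ B ℚ.+ 1ℚ) ℚ.* δ ∎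
    where open ℚ.≤-Reasoning

  above : fromℕ a ≤ √ a * √ a
  above ε 0<ε =
    let
      B , 0<B , K , ∣x∣≤B = eventually-bounded (cauchy (√ a))
      δ , 0<δ , [2B+1]δ≡ε = scale (0<2B+1 0<B) 0<ε
      L , small = 1/-small δ 0<δ
    in K ℕ.⊔ L , λ {n} K⊔L≤n →
      subst (λ η → + a ℚ./ 1 ℚ.≤ √seq a n ℚ.* √seq a n ℚ.+ η) [2B+1]δ≡ε
        (close (√seq a n) (+ 1 ℚ./ suc n) (√seq-upper a n)
          0<B (∣x∣≤B (ℕ.m⊔n≤o⇒m≤o K L K⊔L≤n)) (√seq-nonneg a n)
          (/-mono 0 1 0 n ℕ.z≤n) (/-mono 1 1 n 0 (ℕ.s≤s ℕ.z≤n))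
          (ℚ.<⇒≤ (small (ℕ.m⊔n≤o⇒n≤o K L K⊔L≤n))))

record Instance : Set where
  field
    n          : ℕ
    s          : Fin n → ℕ
    s-positive : ∀ i → 0 ℕ.< s i
    f          : Subset n → ℝ
    f-nonneg   : ∀ X → fromℕ 0 ≤ f X
    f-∅        : f ⊥ ≈ fromℕ 0
    monotone   : ∀ {X Y} → X ⊆ Y → f X ≤ f Y
    submodular : ∀ X Y → f (X ∪ Y) + f (X ∩ Y) ≤ f X + f Y

  size : Subset n → ℕ
  size X = sum (tabulate λ i → if lookup X i then s i else 0)

UnitSizes : Instance → Set
UnitSizes I = ∀ i → s i ≡ 1
  where open Instance I

-- Decision trees over the items outside the index, which collects the items
-- already tried.  A policy without cancellation is one in which the subtree
-- followed when an item does not fit is always `stop`.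
data Tree {n} : Subset n → Set where
  stop : ∀ {T} → Tree T
  try  : ∀ {T} (i : Fin n) → i ∉ T →
         (fits misfits : Tree (⁅ i ⁆ ∪ T)) → Tree T

DetPolicy : Instance → Set
DetPolicy I = Tree (⊥ {n = Instance.n I})

-- Each tree tries every item at most once, so there are only finitely many
-- trees (up to the proofs of i ∉ T): a distribution has finite support.
record RandPolicy (I : Instance) : Set where
  field
    k        : ℕ
    tree     : Fin k → DetPolicy I
    p        : Fin k → ℝ
    p-nonneg : ∀ j → fromℕ 0 ≤ p j
    p-total  : ∑ p ≈ fromℕ 1

module _ (I : Instance) where
  open Instance I

  -- Run C t X Y: started with content X, the tree t ends with content Y.
  -- This is a relation since the comparison with a real C is not decidable;
  -- classically, each tree and content determine exactly one Y.
  data Run (C : ℝ) : ∀ {T} → Tree T → Subset n → Subset n → Set where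
    stop    : ∀ {T X} → Run C (stop {T = T}) X X
    fits    : ∀ {T i X Y} {i∉T : i ∉ T} {t u} → fromℕ (size X ℕ.+ s i) ≤ C →
              Run C t (⁅ i ⁆ ∪ X) Y → Run C (try i i∉T t u) X Y
    misfits : ∀ {T i X Y} {i∉T : i ∉ T} {t u} → C < fromℕ (size X ℕ.+ s i) →
              Run C u X Y → Run C (try i i∉T t u) X Y

  IsALG : ℝ → DetPolicy I → Subset n → Set
  IsALG C t Y = Run C t ⊥ Y

  IsOPT : ℝ → Subset n → Set
  IsOPT C X = fromℕ (size X) ≤ C × (∀ Y → fromℕ (size Y) ≤ C → f Y ≤ f X)

  DetRobust : ℝ → DetPolicy I → Set
  DetRobust α t = ∀ C → fromℕ 0 ≤ C →
    ∀ ALG → IsALG C t ALG → ∀ OPT → IsOPT C OPT → α * f OPT ≤ f ALG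

  RandRobust : ℝ → RandPolicy I → Set
  RandRobust α π = ∀ C → fromℕ 0 ≤ C →
    ∀ (ALG : Fin k → Subset n) → (∀ j → IsALG C (tree j) (ALG j)) →
    ∀ OPT → IsOPT C OPT → α * f OPT ≤ ∑ λ j → p j * f (ALG j)
    where open RandPolicy π

{-# OPTIONS --safe #-}

-- Three items a, b, c: a covers weight 4, half of it shared with b and half with c,
-- while b and c are disjoint and cover 1 + √5 each.  A tree that starts with a
-- collects at most 3 + √5 out of 2 + 2√5 at capacity 2; any other tree collects at
-- most 1 + √5 out of 4 at capacity 1.  Both ratios equal γ = (1 + √5)/4, and the two
-- ratios of a single tree add up to at most 1 + γ, so a random tree cannot have both
-- expected ratios above (1 + γ)/2 = (5 + √5)/8.
module Submission where

open import Defs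
open import Data.Bool.Base using (if_then_else_)
open import Data.Fin.Base using (Fin; zero; suc)
open import Data.Fin.Subset
  using (Subset; Nonempty; ⊥; ⊤; ⁅_⁆; _∪_; _∩_; _∈_; _⊆_; inside; outside)
open import Data.Fin.Subset.Properties
  using (nonempty?; x∈p∩q⁺; x∈p∩q⁻; x∈p∪q⁻; p∩q⊆p; p∩q⊆q; q⊆p∪q; p⊆p∪q; x∈⁅x⁆;
         ∪-identityˡ; ⊆⊤; ⊥⊆)
open import Data.Integer.Base as ℤ using (+_)
import Data.Integer.Properties as ℤ
open import Data.Nat.Base as ℕ using (ℕ; zero; suc; z≤n; s≤s; nonZero)
import Data.Nat.Coprimality as Coprimality
import Data.Nat.Properties as ℕ
open import Data.Product.Base using (Σ-syntax; ∃-syntax; _×_; _,_; proj₁; proj₂)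
open import Data.Rational.Base as ℚ using (ℚ; 0ℚ; 1ℚ; ½; ∣_∣)
import Data.Rational.Properties as ℚ
open import Data.Rational.Solver using (module +-*-Solver)
open import Data.Sum.Base using (_⊎_; inj₁; inj₂)
open import Data.Vec.Base using (_∷_; []; there; lookup; sum; tabulate)
open import Function.Base using (_∘_; _∘′_)
open import Relation.Binary.Bundles using (Preorder)
open import Relation.Binary.PropositionalEquality
  using (_≡_; refl; sym; trans; cong; subst; subst₂; isEquivalence)
import Relation.Binary.Reasoning.Preorder as PreorderReasoning
open import Relation.Nullary.Decidable.Core using (Dec; yes; no; does)
open import Relation.Nullary.Negation.Core using (¬_; contradiction)

-- Inequalities between rationals.

p≤p+ε : ∀ p {ε} → 0ℚ ℚ.< ε → p ℚ.≤ p ℚ.+ ε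
p≤p+ε p {ε} 0<ε = subst (ℚ._≤ p ℚ.+ ε) (ℚ.+-identityʳ p) (ℚ.+-monoʳ-≤ p (ℚ.<⇒≤ 0<ε))

0<½ε : ∀ {ε} → 0ℚ ℚ.< ε → 0ℚ ℚ.< ½ ℚ.* ε
0<½ε = ℚ.*-monoʳ-<-pos ½

½ε+½ε≡ε : ∀ ε → ½ ℚ.* ε ℚ.+ ½ ℚ.* ε ≡ ε
½ε+½ε≡ε = solve 1 (λ ε → con ½ :* ε :+ con ½ :* ε := ε) refl
  where open +-*-Solver

p≤∣p∣ : ∀ p → p ℚ.≤ ∣ p ∣
p≤∣p∣ p with ℚ.≤-total 0ℚ p
... | inj₁ 0≤p = ℚ.≤-reflexive (sym (ℚ.0≤p⇒∣p∣≡p 0≤p))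
... | inj₂ p≤0 = ℚ.≤-trans p≤0 (ℚ.0≤∣p∣ p)

p≤q⇒0≤q-p : ∀ {p q} → p ℚ.≤ q → 0ℚ ℚ.≤ q ℚ.- p
p≤q⇒0≤q-p {p} {q} p≤q =
  subst (ℚ._≤ q ℚ.- p) (ℚ.+-inverseʳ p) (ℚ.+-monoˡ-≤ (ℚ.- p) p≤q)

0≤q-p⇒p≤q : ∀ {p q} → 0ℚ ℚ.≤ q ℚ.- p → p ℚ.≤ q
0≤q-p⇒p≤q {p} {q} 0≤q-p = subst₂ ℚ._≤_ (ℚ.+-identityʳ p) (cancel p q) (ℚ.+-monoʳ-≤ p 0≤q-p)
  where
  open +-*-Solver
  cancel : ∀ p q → p ℚ.+ (q ℚ.- p) ≡ q
  cancel = solve 2 (λ p q → p :+ (q :- p) := q) refl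

*-nonneg : ∀ {p q} → 0ℚ ℚ.≤ p → 0ℚ ℚ.≤ q → 0ℚ ℚ.≤ p ℚ.* q
*-nonneg {p} {q} 0≤p 0≤q =
  subst (ℚ._≤ p ℚ.* q) (ℚ.*-zeroʳ p) (ℚ.*-monoˡ-≤-nonNeg p {{ℚ.nonNegative 0≤p}} 0≤q)

*-pos : ∀ {p q} → 0ℚ ℚ.< p → 0ℚ ℚ.< q → 0ℚ ℚ.< p ℚ.* q
*-pos {p} {q} 0<p 0<q =
  subst (ℚ._< p ℚ.* q) (ℚ.*-zeroʳ p) (ℚ.*-monoʳ-<-pos p {{ℚ.positive 0<p}} 0<q)

+-nonneg : ∀ {p q} → 0ℚ ℚ.≤ p → 0ℚ ℚ.≤ q → 0ℚ ℚ.≤ p ℚ.+ q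
+-nonneg = ℚ.+-mono-≤ {0ℚ} {_} {0ℚ}

-- Expands 0 ≤ (z + δ) * ((y + δ) - x).
*-mono-approx : ∀ {x y z δ A ε} → 0ℚ ℚ.≤ z ℚ.+ δ → x ℚ.≤ y ℚ.+ δ →
  z ℚ.+ (y ℚ.- x) ℚ.+ δ ℚ.≤ A → 0ℚ ℚ.≤ δ → A ℚ.* δ ℚ.≤ ε →
  z ℚ.* x ℚ.≤ z ℚ.* y ℚ.+ ε
*-mono-approx {x} {y} {z} {δ} {A} {ε} 0≤z+δ x≤y+δ ≤A 0≤δ Aδ≤ε = 0≤q-p⇒p≤q (begin
  0ℚ
    ≤⟨ +-nonneg (+-nonneg
         (*-nonneg 0≤z+δ (p≤q⇒0≤q-p x≤y+δ)) (*-nonneg (p≤q⇒0≤q-p ≤A) 0≤δ))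
         (p≤q⇒0≤q-p Aδ≤ε) ⟩
  ((z ℚ.+ δ) ℚ.* ((y ℚ.+ δ) ℚ.- x) ℚ.+ (A ℚ.- (z ℚ.+ (y ℚ.- x) ℚ.+ δ)) ℚ.* δ)
    ℚ.+ (ε ℚ.- A ℚ.* δ)
    ≡⟨ expand x y z δ A ε ⟩
  (z ℚ.* y ℚ.+ ε) ℚ.- z ℚ.* x ∎)
  where
  open ℚ.≤-Reasoning
  open +-*-Solver
  expand : ∀ x y z δ A ε →
    ((z ℚ.+ δ) ℚ.* ((y ℚ.+ δ) ℚ.- x) ℚ.+ (A ℚ.- (z ℚ.+ (y ℚ.- x) ℚ.+ δ)) ℚ.* δ)
      ℚ.+ (ε ℚ.- A ℚ.* δ) ≡ (z ℚ.* y ℚ.+ ε) ℚ.- z ℚ.* x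
  expand = solve 6 (λ x y z δ A ε →
    ((z :+ δ) :* ((y :+ δ) :- x) :+ (A :- (z :+ (y :- x) :+ δ)) :* δ)
      :+ (ε :- A :* δ) := (z :* y :+ ε) :- z :* x) refl

abstract
  -- The witness is the minimum of `ε / A` and 1. The cap at 1 lets a leftover `δ` be absorbed into
  -- the constant `A`.
  small-multiple : ∀ {A ε} → 0ℚ ℚ.< A → 0ℚ ℚ.< ε →
    ∃[ δ ] 0ℚ ℚ.< δ × δ ℚ.≤ 1ℚ × A ℚ.* δ ℚ.≤ ε
  small-multiple {A} {ε} 0<A 0<ε =
    δ ℚ.⊓ 1ℚ , 0<δ⊓1 , ℚ.p⊓q≤q δ 1ℚ ,
    ℚ.≤-trans (ℚ.*-monoˡ-≤-nonNeg A {{ℚ.nonNegative (ℚ.<⇒≤ 0<A)}} (ℚ.p⊓q≤p δ 1ℚ))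
      (ℚ.≤-reflexive Aδ≡ε)
    where
    instance
      A>0 : ℚ.Positive A
      A>0 = ℚ.positive 0<A
      A≢0 : ℚ.NonZero A
      A≢0 = ℚ.pos⇒nonZero A
    δ : ℚ
    δ = ℚ.1/ A ℚ.* ε
    0<δ : 0ℚ ℚ.< δ
    0<δ = *-pos (ℚ.positive⁻¹ (ℚ.1/ A) {{ℚ.1/pos⇒pos A}}) 0<ε
    0<δ⊓1 : 0ℚ ℚ.< δ ℚ.⊓ 1ℚ
    0<δ⊓1 with ℚ.≤-total δ 1ℚ
    ... | inj₁ δ≤1 = subst (0ℚ ℚ.<_) (sym (ℚ.p≤q⇒p⊓q≡p δ≤1)) 0<δ
    ... | inj₂ 1≤δ = subst (0ℚ ℚ.<_) (sym (ℚ.p≥q⇒p⊓q≡q 1≤δ)) (ℚ.positive⁻¹ 1ℚ)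
    Aδ≡ε : A ℚ.* δ ≡ ε
    Aδ≡ε = trans (sym (ℚ.*-assoc A (ℚ.1/ A) ε))
      (trans (cong (ℚ._* ε) (ℚ.*-inverseʳ A)) (ℚ.*-identityˡ ε))

-- The quotient `+ n / 1` is reduced by a gcd that is stuck for a variable `n`; the explicit
-- fraction exposes its numerator to comparison.
n/1≡mkℚ : ∀ n → + n ℚ./ 1 ≡ ℚ.mkℚ (+ n) 0 (Coprimality.sym (Coprimality.1-coprimeTo n))
n/1≡mkℚ n = ℚ.↥p/↧p≡p (ℚ.mkℚ (+ n) 0 (Coprimality.sym (Coprimality.1-coprimeTo n)))

/1-mono-≤ : ∀ {m n} → m ℕ.≤ n → + m ℚ./ 1 ℚ.≤ + n ℚ./ 1
/1-mono-≤ {m} {n} m≤n rewrite n/1≡mkℚ m | n/1≡mkℚ n =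
  ℚ.*≤* (ℤ.*-monoʳ-≤-nonNeg (+ 1) (ℤ.+≤+ m≤n))

/1-mono-< : ∀ {m n} → m ℕ.< n → + m ℚ./ 1 ℚ.< + n ℚ./ 1
/1-mono-< {m} {n} m<n rewrite n/1≡mkℚ m | n/1≡mkℚ n =
  ℚ.*<* (ℤ.*-monoʳ-<-pos (+ 1) (ℤ.+<+ m<n))

-- Order and arithmetic of the reals, via tails of their sequences.

Eventually : (ℕ → Set) → Set
Eventually P = ∃[ N ] ∀ {n} → N ℕ.≤ n → P n

both : ∀ {P Q : ℕ → Set} → Eventually P → Eventually Q → Eventually (λ n → P n × Q n)
both (M , p) (N , q) = M ℕ.⊔ N , λ M⊔N≤n →
  p (ℕ.m⊔n≤o⇒m≤o M N M⊔N≤n) , q (ℕ.m⊔n≤o⇒n≤o M N M⊔N≤n)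

map : ∀ {P Q : ℕ → Set} → (∀ n → P n → Q n) → Eventually P → Eventually Q
map f (N , p) = N , λ {n} N≤n → f n (p N≤n)

-- The order on ℝ unfolds to a statement about sequences, so its endpoints cannot be
-- inferred: the lemmas about it take them explicitly.
pointwise-≤ : ∀ x y → Eventually (λ n → seq x n ℚ.≤ seq y n) → x ≤ y
pointwise-≤ x y (N , x≤y) ε 0<ε = N , λ {n} N≤n → ℚ.≤-trans (x≤y N≤n) (p≤p+ε (seq y n) 0<ε)

pointwise-≡ : ∀ x y → (∀ n → seq x n ≡ seq y n) → x ≤ y
pointwise-≡ x y x≡y = pointwise-≤ x y (0 , λ {n} _ → ℚ.≤-reflexive (x≡y n))

≤-refl : ∀ x → x ≤ x
≤-refl x = pointwise-≡ x x λ _ → refl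

≤-trans : ∀ x y z → x ≤ y → y ≤ z → x ≤ z
≤-trans x y z x≤y y≤z ε 0<ε =
  map (λ n (p , q) → begin
      seq x n                                    ≤⟨ p ⟩
      seq y n ℚ.+ ½ ℚ.* ε                        ≤⟨ ℚ.+-monoˡ-≤ (½ ℚ.* ε) q ⟩
      (seq z n ℚ.+ ½ ℚ.* ε) ℚ.+ ½ ℚ.* ε          ≡⟨ ℚ.+-assoc (seq z n) (½ ℚ.* ε) (½ ℚ.* ε) ⟩
      seq z n ℚ.+ (½ ℚ.* ε ℚ.+ ½ ℚ.* ε)          ≡⟨ cong (seq z n ℚ.+_) (½ε+½ε≡ε ε) ⟩
      seq z n ℚ.+ ε                              ∎)
    (both (x≤y (½ ℚ.* ε) (0<½ε 0<ε)) (y≤z (½ ℚ.* ε) (0<½ε 0<ε)))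
  where open ℚ.≤-Reasoning

-- Agreement of two sequences at every index does not by itself make the reals `_≡_`, so algebraic
-- identities also enter the chains as `≲` steps.
≤-preorder : Preorder _ _ _
≤-preorder = record
  { Carrier    = ℝ
  ; _≈_        = _≡_
  ; _≲_        = _≤_
  ; isPreorder = record
    { isEquivalence = isEquivalence
    ; reflexive     = λ { {x} refl → ≤-refl x }
    ; trans         = λ {x} {y} {z} → ≤-trans x y z
    }
  }

module ≤-Reasoning = PreorderReasoning ≤-preorder

+-mono-≤ : ∀ u v x y → u ≤ v → x ≤ y → u + x ≤ v + y
+-mono-≤ u v x y u≤v x≤y ε 0<ε =
  map (λ n (p , q) → ℚ.≤-trans (ℚ.+-mono-≤ p q) (ℚ.≤-reflexive (trans
      (rearrange (seq v n) (seq y n) (½ ℚ.* ε))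
      (cong (seq v n ℚ.+ seq y n ℚ.+_) (½ε+½ε≡ε ε)))))
    (both (u≤v (½ ℚ.* ε) (0<½ε 0<ε)) (x≤y (½ ℚ.* ε) (0<½ε 0<ε)))
  where
  open +-*-Solver
  rearrange : ∀ v y δ → (v ℚ.+ δ) ℚ.+ (y ℚ.+ δ) ≡ v ℚ.+ y ℚ.+ (δ ℚ.+ δ)
  rearrange = solve 3 (λ v y δ → (v :+ δ) :+ (y :+ δ) := v :+ y :+ (δ :+ δ)) refl

+-comm-≤ : ∀ x y → x + y ≤ y + x
+-comm-≤ x y = pointwise-≡ (x + y) (y + x) λ n → ℚ.+-comm (seq x n) (seq y n)

abstract
  bounded : ∀ x → ∃[ B ] 0ℚ ℚ.≤ B × Eventually (λ n → ∣ seq x n ∣ ℚ.≤ B)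
  bounded x with N , close ← cauchy x 1ℚ (ℚ.positive⁻¹ 1ℚ) =
    ∣ seq x N ∣ ℚ.+ 1ℚ ,
    +-nonneg (ℚ.0≤∣p∣ (seq x N)) (ℚ.<⇒≤ (ℚ.positive⁻¹ 1ℚ)) ,
    N , λ {n} N≤n → ℚ.≤-trans
      (ℚ.≤-trans (ℚ.≤-reflexive (cong ∣_∣ (split (seq x N) (seq x n))))
        (ℚ.∣p+q∣≤∣p∣+∣q∣ (seq x N) (seq x n ℚ.- seq x N)))
      (ℚ.+-monoʳ-≤ ∣ seq x N ∣ (ℚ.<⇒≤ (close N≤n ℕ.≤-refl)))
    where
    open +-*-Solver
    split : ∀ a b → b ≡ a ℚ.+ (b ℚ.- a)
    split = solve 2 (λ a b → b := a :+ (b :- a)) refl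

-- Both hypotheses hold only up to a slack `δ` at each index. The sequences are eventually bounded,
-- so the error in the product is at most a constant times `δ`, and `δ` is chosen after that
-- constant.
*-monoˡ-≤-nonNeg : ∀ z x y → fromℕ 0 ≤ z → x ≤ y → z * x ≤ z * y
*-monoˡ-≤-nonNeg z x y 0≤z x≤y ε 0<ε =
  let
    X , 0≤X , ∣x∣≤X = bounded x
    Y , 0≤Y , ∣y∣≤Y = bounded y
    Z , 0≤Z , ∣z∣≤Z = bounded z
    -- The constant bounds `z + (y - x) + δ`; its last summand 1 accounts for `δ ≤ 1`.
    δ , 0<δ , δ≤1 , Aδ≤ε = small-multiple {Z ℚ.+ (Y ℚ.+ X) ℚ.+ 1ℚ}
      (ℚ.+-mono-≤-< {0ℚ} {_} {0ℚ} (+-nonneg 0≤Z (+-nonneg 0≤Y 0≤X)) (ℚ.positive⁻¹ 1ℚ)) 0<ε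
  in map (λ n ((0≤z+δ , x≤y+δ) , ∣x∣≤X , ∣y∣≤Y , ∣z∣≤Z) → *-mono-approx
      {seq x n} {seq y n} {seq z n} {δ} {Z ℚ.+ (Y ℚ.+ X) ℚ.+ 1ℚ} {ε}
      0≤z+δ x≤y+δ
      (ℚ.+-mono-≤ (ℚ.+-mono-≤ (ℚ.≤-trans (p≤∣p∣ (seq z n)) ∣z∣≤Z)
        (ℚ.+-mono-≤ (ℚ.≤-trans (p≤∣p∣ (seq y n)) ∣y∣≤Y)
          (ℚ.≤-trans (p≤∣p∣ (ℚ.- seq x n))
            (subst (ℚ._≤ X) (sym (ℚ.∣-p∣≡∣p∣ (seq x n))) ∣x∣≤X)))) δ≤1)
      (ℚ.<⇒≤ 0<δ) Aδ≤ε)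
    (both (both (0≤z δ 0<δ) (x≤y δ 0<δ)) (both ∣x∣≤X (both ∣y∣≤Y ∣z∣≤Z)))

-- At a late index the two gaps force `bc - ac ≥ εη`, while the assumed inequality with slack `½ εη`
-- forces `bc - ac ≤ ½ εη`. Stated for products, it refutes a ratio without dividing reals.
<⇒*≰ : ∀ x y z → x < y → fromℕ 0 < z → ¬ (y * z ≤ x * z)
<⇒*≰ x y z (ε , 0<ε , x+ε≤y) (η , 0<η , η≤z) yz≤xz =
  let
    0<εη = *-pos 0<ε 0<η
    N , h = both {Q = λ n → seq (y * z) n ℚ.≤ seq (x * z) n ℚ.+ ½ ℚ.* (ε ℚ.* η)}
      (both x+ε≤y η≤z) (yz≤xz (½ ℚ.* (ε ℚ.* η)) (0<½ε 0<εη))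
    (a+ε≤b , η≤c) , bc≤ac = h ℕ.≤-refl
    a = seq x N
    b = seq y N
    c = seq z N
  -- Three nonnegative terms and the positive `½ εη` would add up to zero.
  in ℚ.<-irrefl (sym (cancel a b c ε η))
    (ℚ.+-mono-≤-< {0ℚ} {_} {0ℚ} (+-nonneg (+-nonneg
      (*-nonneg (p≤q⇒0≤q-p a+ε≤b) (ℚ.≤-trans (ℚ.<⇒≤ 0<η)
        (ℚ.≤-trans (ℚ.≤-reflexive (sym (ℚ.+-identityˡ η))) η≤c)))
      (*-nonneg (ℚ.<⇒≤ 0<ε) (p≤q⇒0≤q-p η≤c))) (p≤q⇒0≤q-p bc≤ac)) (0<½ε 0<εη))
  where
  open +-*-Solver
  cancel : ∀ a b c ε η → (((b ℚ.- (a ℚ.+ ε)) ℚ.* c ℚ.+ ε ℚ.* (c ℚ.- (0ℚ ℚ.+ η)))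
      ℚ.+ ((a ℚ.* c ℚ.+ ½ ℚ.* (ε ℚ.* η)) ℚ.- b ℚ.* c)) ℚ.+ ½ ℚ.* (ε ℚ.* η) ≡ 0ℚ
  cancel = solve 5 (λ a b c ε η → (((b :- (a :+ ε)) :* c :+ ε :* (c :- (con 0ℚ :+ η)))
      :+ ((a :* c :+ con ½ :* (ε :* η)) :- b :* c)) :+ con ½ :* (ε :* η) := con 0ℚ) refl

+-pos : ∀ x y → fromℕ 0 < x → fromℕ 0 < y → fromℕ 0 < x + y
+-pos x y (ε , 0<ε , ε≤x) (η , 0<η , η≤y) = ε ℚ.+ η , ℚ.+-mono-< {0ℚ} {_} {0ℚ} 0<ε 0<η ,
  map (λ n (p , q) → ℚ.≤-trans (ℚ.≤-reflexive (rearrange ε η)) (ℚ.+-mono-≤ p q)) (both ε≤x η≤y)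
  where
  open +-*-Solver
  rearrange : ∀ ε η → 0ℚ ℚ.+ (ε ℚ.+ η) ≡ (0ℚ ℚ.+ ε) ℚ.+ (0ℚ ℚ.+ η)
  rearrange = solve 2 (λ ε η → con 0ℚ :+ (ε :+ η) := (con 0ℚ :+ ε) :+ (con 0ℚ :+ η)) refl

fromℕ-mono-≤ : ∀ {m n} → m ℕ.≤ n → fromℕ m ≤ fromℕ n
fromℕ-mono-≤ {m} {n} m≤n = pointwise-≤ (fromℕ m) (fromℕ n) (0 , λ _ → /1-mono-≤ m≤n)

fromℕ-mono-< : ∀ {m n} → m ℕ.< n → fromℕ m < fromℕ n
fromℕ-mono-< {m} {n} m<n = q ℚ.- p ,
  subst (ℚ._< q ℚ.- p) (ℚ.+-inverseʳ p) (ℚ.+-monoˡ-< (ℚ.- p) (/1-mono-< m<n)) ,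
  0 , λ _ → ℚ.≤-reflexive (cancel p q)
  where
  p = + m ℚ./ 1
  q = + n ℚ./ 1
  open +-*-Solver
  cancel : ∀ p q → p ℚ.+ (q ℚ.- p) ≡ q
  cancel = solve 2 (λ p q → p :+ (q :- p) := q) refl

<⇒≱ : ∀ x y → x < y → ¬ (y ≤ x)
<⇒≱ x y x<y y≤x = <⇒*≰ x y (fromℕ 1) x<y (fromℕ-mono-< {0} {1} (ℕ.s≤s ℕ.z≤n)) (begin
  y * fromℕ 1  ≲⟨ pointwise-≡ (y * fromℕ 1) y (λ n → ℚ.*-identityʳ (seq y n)) ⟩
  y            ≲⟨ y≤x ⟩
  x            ≲⟨ pointwise-≡ x (x * fromℕ 1) (λ n → sym (ℚ.*-identityʳ (seq x n))) ⟩
  x * fromℕ 1  ∎)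
  where open ≤-Reasoning

fromℕ-cancel-≤ : ∀ {m n} → fromℕ m ≤ fromℕ n → m ℕ.≤ n
fromℕ-cancel-≤ {m} {n} m≤n = ℕ.≮⇒≥ λ n<m →
  <⇒≱ (fromℕ n) (fromℕ m) (fromℕ-mono-< {n} {m} n<m) m≤n

-- Finite sums and averages of reals.

∑-mono-≤ : ∀ {k} (u v : Fin k → ℝ) → (∀ j → u j ≤ v j) → ∑ u ≤ ∑ v
∑-mono-≤ {zero}  u v u≤v = ≤-refl (fromℕ 0)
∑-mono-≤ {suc k} u v u≤v = +-mono-≤ (u zero) (v zero) (∑ λ j → u (suc j)) (∑ λ j → v (suc j))
  (u≤v zero) (∑-mono-≤ (λ j → u (suc j)) (λ j → v (suc j)) λ j → u≤v (suc j))

-- Sums are formed termwise on sequences, so equality holds at every index; `pointwise-≡` then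
-- yields `≤` in whichever direction is wanted.
∑-+ : ∀ {k} (u v : Fin k → ℝ) n → seq (∑ λ j → u j + v j) n ≡ seq (∑ u + ∑ v) n
∑-+ {zero}  u v n = refl
∑-+ {suc k} u v n = trans
  (cong (seq (u zero) n ℚ.+ seq (v zero) n ℚ.+_) (∑-+ (λ j → u (suc j)) (λ j → v (suc j)) n))
  (rearrange (seq (u zero) n) (seq (v zero) n)
    (seq (∑ λ j → u (suc j)) n) (seq (∑ λ j → v (suc j)) n))
  where
  open +-*-Solver
  rearrange : ∀ a b c d → (a ℚ.+ b) ℚ.+ (c ℚ.+ d) ≡ (a ℚ.+ c) ℚ.+ (b ℚ.+ d)
  rearrange = solve 4 (λ a b c d → (a :+ b) :+ (c :+ d) := (a :+ c) :+ (b :+ d)) refl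

∑-*ʳ : ∀ {k} (u : Fin k → ℝ) c n → seq (∑ λ j → u j * c) n ≡ seq (∑ u * c) n
∑-*ʳ {zero}  u c n = sym (ℚ.*-zeroˡ (seq c n))
∑-*ʳ {suc k} u c n = trans
  (cong (seq (u zero) n ℚ.* seq c n ℚ.+_) (∑-*ʳ (λ j → u (suc j)) c n))
  (sym (ℚ.*-distribʳ-+ (seq c n) (seq (u zero) n) (seq (∑ λ j → u (suc j)) n)))

-- Linearity of expectation: it merges the expected values at two capacities into the expectation of
-- one combined value per tree.
∑-linear : ∀ {k} a b (p u v : Fin k → ℝ) n →
  seq (a * ∑ (λ j → p j * u j) + b * ∑ (λ j → p j * v j)) n ≡
  seq (∑ λ j → p j * (a * u j + b * v j)) n
∑-linear {zero}  a b p u v n = zeros (seq a n) (seq b n)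
  where
  open +-*-Solver
  zeros : ∀ a b → a ℚ.* 0ℚ ℚ.+ b ℚ.* 0ℚ ≡ 0ℚ
  zeros = solve 2 (λ a b → a :* con 0ℚ :+ b :* con 0ℚ := con 0ℚ) refl
∑-linear {suc k} a b p u v n = trans
  (rearrange (seq a n) (seq b n) (seq (p zero) n) (seq (u zero) n) (seq (v zero) n)
    (seq (∑ λ j → p (suc j) * u (suc j)) n) (seq (∑ λ j → p (suc j) * v (suc j)) n))
  (cong (seq (p zero * (a * u zero + b * v zero)) n ℚ.+_)
    (∑-linear a b (λ j → p (suc j)) (λ j → u (suc j)) (λ j → v (suc j)) n))
  where
  open +-*-Solver
  rearrange : ∀ a b p u v s t →
    a ℚ.* (p ℚ.* u ℚ.+ s) ℚ.+ b ℚ.* (p ℚ.* v ℚ.+ t) ≡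
    p ℚ.* (a ℚ.* u ℚ.+ b ℚ.* v) ℚ.+ (a ℚ.* s ℚ.+ b ℚ.* t)
  rearrange = solve 7 (λ a b p u v s t →
    a :* (p :* u :+ s) :+ b :* (p :* v :+ t) :=
    p :* (a :* u :+ b :* v) :+ (a :* s :+ b :* t)) refl

*-comm-≤ : ∀ x y → x * y ≤ y * x
*-comm-≤ x y = pointwise-≡ (x * y) (y * x) λ n → ℚ.*-comm (seq x n) (seq y n)

-- Replacing each `v j` by `K` gives `K * ∑ p`; nonnegativity of `K` allows `∑ p ≤ 1` to be
-- multiplied by it.
mean-≤ : ∀ {k} (p v : Fin k → ℝ) K → (∀ j → fromℕ 0 ≤ p j) → ∑ p ≈ fromℕ 1 →
         fromℕ 0 ≤ K → (∀ j → v j ≤ K) → ∑ (λ j → p j * v j) ≤ K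
mean-≤ p v K 0≤p (∑p≤1 , _) 0≤K v≤K = begin
  (∑ λ j → p j * v j)
    ≲⟨ ∑-mono-≤ (λ j → p j * v j) (λ j → p j * K)
         (λ j → *-monoˡ-≤-nonNeg (p j) (v j) K (0≤p j) (v≤K j)) ⟩
  (∑ λ j → p j * K)
    ≲⟨ pointwise-≡ (∑ λ j → p j * K) (∑ p * K) (∑-*ʳ p K) ⟩
  ∑ p * K
    ≲⟨ *-comm-≤ (∑ p) K ⟩
  K * ∑ p
    ≲⟨ *-monoˡ-≤-nonNeg K (∑ p) (fromℕ 1) 0≤K ∑p≤1 ⟩
  K * fromℕ 1
    ≲⟨ pointwise-≡ (K * fromℕ 1) K (λ n → ℚ.*-identityʳ (seq K n)) ⟩
  K ∎
  where open ≤-Reasoning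

-- Weighted coverage functions: `hit A w` is an atom of weight `w` covered by the items in `A`.

hit : ∀ {n} → Subset n → ℝ → Subset n → ℝ
hit A w X = if does (nonempty? (A ∩ X)) then w else fromℕ 0

hit-≤ : ∀ {n} (A : Subset n) w X Y → fromℕ 0 ≤ w →
        (Nonempty (A ∩ X) → Nonempty (A ∩ Y)) → hit A w X ≤ hit A w Y
hit-≤ A w X Y 0≤w X⇒Y with nonempty? (A ∩ X) | nonempty? (A ∩ Y)
... | yes _ | yes _  = ≤-refl w
... | yes x | no  ¬y = contradiction (X⇒Y x) ¬y
... | no  _ | yes _  = 0≤w
... | no  _ | no  _  = ≤-refl (fromℕ 0)

∩-nonempty-mono : ∀ {n} (A : Subset n) {X Y} → X ⊆ Y → Nonempty (A ∩ X) → Nonempty (A ∩ Y)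
∩-nonempty-mono A {X} X⊆Y (i , i∈A∩X) =
  let i∈A , i∈X = x∈p∩q⁻ A X i∈A∩X in i , x∈p∩q⁺ (i∈A , X⊆Y i∈X)

-- If `X` meets `A`, compare `X ∪ Y` with `X` and `X ∩ Y` with `Y`. Otherwise every element of `A`
-- in the union lies in `Y`, and the two comparisons are exchanged.
hit-submodular : ∀ {n} (A : Subset n) w X Y → fromℕ 0 ≤ w →
                 hit A w (X ∪ Y) + hit A w (X ∩ Y) ≤ hit A w X + hit A w Y
hit-submodular A w X Y 0≤w = go (nonempty? (A ∩ X))
  where
  go : Dec (Nonempty (A ∩ X)) → hit A w (X ∪ Y) + hit A w (X ∩ Y) ≤ hit A w X + hit A w Y
  go (yes x) = +-mono-≤ (hit A w (X ∪ Y)) (hit A w X) (hit A w (X ∩ Y)) (hit A w Y)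
    (hit-≤ A w (X ∪ Y) X 0≤w λ _ → x)
    (hit-≤ A w (X ∩ Y) Y 0≤w (∩-nonempty-mono A (p∩q⊆q X Y)))
  go (no ¬x) = begin
    hit A w (X ∪ Y) + hit A w (X ∩ Y)
      ≲⟨ +-mono-≤ (hit A w (X ∪ Y)) (hit A w Y) (hit A w (X ∩ Y)) (hit A w X)
           (hit-≤ A w (X ∪ Y) Y 0≤w meets-Y)
           (hit-≤ A w (X ∩ Y) X 0≤w (∩-nonempty-mono A (p∩q⊆p X Y))) ⟩
    hit A w Y + hit A w X
      ≲⟨ +-comm-≤ (hit A w Y) (hit A w X) ⟩
    hit A w X + hit A w Y ∎
    where
    open ≤-Reasoning
    meets-Y : Nonempty (A ∩ (X ∪ Y)) → Nonempty (A ∩ Y)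
    meets-Y (i , i∈) with i∈A , i∈X∪Y ← x∈p∩q⁻ A (X ∪ Y) i∈ | x∈p∪q⁻ X Y i∈X∪Y
    ... | inj₁ i∈X = contradiction (i , x∈p∩q⁺ (i∈A , i∈X)) ¬x
    ... | inj₂ i∈Y = i , x∈p∩q⁺ (i∈A , i∈Y)

coverage : ∀ {k n} → (Fin k → Subset n) → (Fin k → ℝ) → Subset n → ℝ
coverage A w X = ∑ λ j → hit (A j) (w j) X

module _ {k n} (A : Fin k → Subset n) (w : Fin k → ℝ) (0≤w : ∀ j → fromℕ 0 ≤ w j) where

  coverage-monotone : ∀ {X Y} → X ⊆ Y → coverage A w X ≤ coverage A w Y
  coverage-monotone {X} {Y} X⊆Y = ∑-mono-≤ (λ j → hit (A j) (w j) X) (λ j → hit (A j) (w j) Y)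
    λ j → hit-≤ (A j) (w j) X Y (0≤w j) (∩-nonempty-mono (A j) X⊆Y)

  coverage-submodular : ∀ X Y →
    coverage A w (X ∪ Y) + coverage A w (X ∩ Y) ≤ coverage A w X + coverage A w Y
  coverage-submodular X Y = begin
    coverage A w (X ∪ Y) + coverage A w (X ∩ Y)
      ≲⟨ pointwise-≡ (∑ (hits (X ∪ Y)) + ∑ (hits (X ∩ Y))) (∑ joint)
           (λ n → sym (∑-+ (hits (X ∪ Y)) (hits (X ∩ Y)) n)) ⟩
    ∑ joint
      ≲⟨ ∑-mono-≤ joint separate (λ j → hit-submodular (A j) (w j) X Y (0≤w j)) ⟩
    ∑ separate
      ≲⟨ pointwise-≡ (∑ separate) (∑ (hits X) + ∑ (hits Y)) (∑-+ (hits X) (hits Y)) ⟩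
    coverage A w X + coverage A w Y ∎
    where
    open ≤-Reasoning
    hits : Subset n → Fin k → ℝ
    hits Z j = hit (A j) (w j) Z
    joint separate : Fin k → ℝ
    joint j    = hits (X ∪ Y) j + hits (X ∩ Y) j
    separate j = hits X j + hits Y j

-- Sizes, and runs of a tree at a natural capacity.

sizeBy : ∀ {n} → (Fin n → ℕ) → Subset n → ℕ
sizeBy s X = sum (tabulate λ i → if lookup X i then s i else 0)

-- Only an inequality, because `i` may already lie in `X`. Having the sizes as an argument of
-- `sizeBy` lets the induction drop the first item.
size-⁅⁆∪ : ∀ {n} (s : Fin n → ℕ) i X → sizeBy s (⁅ i ⁆ ∪ X) ℕ.≤ sizeBy s X ℕ.+ s i
size-⁅⁆∪ s zero (x ∷ X) rewrite ∪-identityˡ X = begin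
  s zero ℕ.+ rest                                        ≡⟨ ℕ.+-comm (s zero) rest ⟩
  rest ℕ.+ s zero                                        ≤⟨ ℕ.+-monoˡ-≤ (s zero) (ℕ.m≤n+m rest _) ⟩
  (if x then s zero else 0) ℕ.+ rest ℕ.+ s zero          ∎
  where
  open ℕ.≤-Reasoning
  rest = sizeBy (s ∘ suc) X
size-⁅⁆∪ s (suc i) (x ∷ X) = begin
  s₀ ℕ.+ sizeBy (s ∘ suc) (⁅ i ⁆ ∪ X)          ≤⟨ ℕ.+-monoʳ-≤ s₀ (size-⁅⁆∪ (s ∘ suc) i X) ⟩
  s₀ ℕ.+ (sizeBy (s ∘ suc) X ℕ.+ s (suc i))    ≡⟨ ℕ.+-assoc s₀ _ _ ⟨
  s₀ ℕ.+ sizeBy (s ∘ suc) X ℕ.+ s (suc i)      ∎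
  where
  open ℕ.≤-Reasoning
  s₀ = if x then s zero else 0

module _ (I : Instance) (c : ℕ) where
  open Instance I

  -- At a natural capacity the fit test is decidable, so a run can be constructed. The inclusion and
  -- the size bound are the invariants by which outputs are classified later.
  run : ∀ {T} (t : Tree T) X → size X ℕ.≤ c →
        ∃[ Y ] Run I (fromℕ c) t X Y × X ⊆ Y × size Y ℕ.≤ c
  run stop X X≤c = X , stop , (λ i∈X → i∈X) , X≤c
  run (try i i∉T t u) X X≤c with size X ℕ.+ s i ℕ.≤? c
  ... | yes fit
    with Y , r , X∪i⊆Y , Y≤c ← run t (⁅ i ⁆ ∪ X) (ℕ.≤-trans (size-⁅⁆∪ s i X) fit)
    = Y , fits (fromℕ-mono-≤ fit) r , X∪i⊆Y ∘′ q⊆p∪q ⁅ i ⁆ X , Y≤c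
  ... | no ¬fit with Y , r , X⊆Y , Y≤c ← run u X X≤c
    = Y , misfits (fromℕ-mono-< (ℕ.≰⇒> ¬fit)) r , X⊆Y , Y≤c

  -- An item that enters the knapsack is never removed, so the root of a tree constrains its output.
  run-first-fits : ∀ {i i∉T} (t u : Tree (⁅ i ⁆ ∪ ⊥)) → size ⊥ ℕ.+ s i ℕ.≤ c →
                   ∃[ Y ] IsALG I (fromℕ c) (try i i∉T t u) Y × i ∈ Y × size Y ℕ.≤ c
  run-first-fits {i} t u fit
    with Y , r , i∪⊥⊆Y , Y≤c ← run t (⁅ i ⁆ ∪ ⊥) (ℕ.≤-trans (size-⁅⁆∪ s i ⊥) fit)
    = Y , fits (fromℕ-mono-≤ fit) r , i∪⊥⊆Y (p⊆p∪q ⊥ (x∈⁅x⁆ i)) , Y≤c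

-- The three-item instance, over any nonnegative `r` with square 5.

module GoldenInstance (r : ℝ) (0≤r : fromℕ 0 ≤ r) (r²≈5 : r * r ≈ fromℕ 5) where

  -- Slack 1 in the hypotheses gives `r ≥ -1` and `4 ≤ r² ≤ 6` eventually. These crude bounds
  -- suffice: `1 ≤ r` makes the weights nonnegative, and `r ≤ 3` makes `a` the best single item.
  1≤r≤3 : Eventually λ n → 1ℚ ℚ.≤ seq r n × seq r n ℚ.≤ + 3 ℚ./ 1
  1≤r≤3 = map (λ n ((0≤r+1 , r²≤6) , 5≤r²+1) →
      lower (seq r n) 0≤r+1 5≤r²+1 , upper (seq r n) 0≤r+1 r²≤6)
    (both {Q = λ n → + 5 ℚ./ 1 ℚ.≤ seq r n ℚ.* seq r n ℚ.+ 1ℚ}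
      (both {P = λ n → 0ℚ ℚ.≤ seq r n ℚ.+ 1ℚ} {λ n → seq r n ℚ.* seq r n ℚ.≤ + 5 ℚ./ 1 ℚ.+ 1ℚ}
         (0≤r 1ℚ 0<1) (proj₁ r²≈5 1ℚ 0<1)) (proj₂ r²≈5 1ℚ 0<1))
    where
    open +-*-Solver
    0<1 : 0ℚ ℚ.< 1ℚ
    0<1 = ℚ.positive⁻¹ 1ℚ
    -- For `x < 1` both summands are nonnegative, yet they add up to -3; `above` excludes `x > 3` in
    -- the same way.
    below : ∀ x → (1ℚ ℚ.- x) ℚ.* (x ℚ.+ 1ℚ) ℚ.+ ((x ℚ.* x ℚ.+ 1ℚ) ℚ.- + 5 ℚ./ 1) ≡ ℚ.- (+ 3 ℚ./ 1)
    below = solve 1 (λ x → (con 1ℚ :- x) :* (x :+ con 1ℚ) :+ ((x :* x :+ con 1ℚ) :- con (+ 5 ℚ./ 1))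
      := con (ℚ.- (+ 3 ℚ./ 1))) refl
    above : ∀ x → (x ℚ.- + 3 ℚ./ 1) ℚ.* ((x ℚ.+ 1ℚ) ℚ.+ + 2 ℚ./ 1) ℚ.+ ((+ 5 ℚ./ 1 ℚ.+ 1ℚ) ℚ.- x ℚ.* x)
            ≡ ℚ.- (+ 3 ℚ./ 1)
    above = solve 1 (λ x → (x :- con (+ 3 ℚ./ 1)) :* ((x :+ con 1ℚ) :+ con (+ 2 ℚ./ 1))
      :+ ((con (+ 5 ℚ./ 1) :+ con 1ℚ) :- x :* x) := con (ℚ.- (+ 3 ℚ./ 1))) refl
    0≰-3 : ¬ (0ℚ ℚ.≤ ℚ.- (+ 3 ℚ./ 1))
    0≰-3 (ℚ.*≤* ())
    lower : ∀ x → 0ℚ ℚ.≤ x ℚ.+ 1ℚ → + 5 ℚ./ 1 ℚ.≤ x ℚ.* x ℚ.+ 1ℚ → 1ℚ ℚ.≤ x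
    lower x 0≤x+1 5≤x²+1 = ℚ.≮⇒≥ λ x<1 → 0≰-3 (subst (0ℚ ℚ.≤_) (below x)
      (+-nonneg (*-nonneg (p≤q⇒0≤q-p (ℚ.<⇒≤ x<1)) 0≤x+1) (p≤q⇒0≤q-p 5≤x²+1)))
    upper : ∀ x → 0ℚ ℚ.≤ x ℚ.+ 1ℚ → x ℚ.* x ℚ.≤ + 5 ℚ./ 1 ℚ.+ 1ℚ → x ℚ.≤ + 3 ℚ./ 1
    upper x 0≤x+1 x²≤6 = ℚ.≮⇒≥ λ 3<x → 0≰-3 (subst (0ℚ ℚ.≤_) (above x)
      (+-nonneg (*-nonneg (p≤q⇒0≤q-p (ℚ.<⇒≤ 3<x)) (+-nonneg 0≤x+1 (ℚ.nonNegative⁻¹ (+ 2 ℚ./ 1))))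
        (p≤q⇒0≤q-p x²≤6)))

  r-1 1+r 3+r 2+2r : ℝ
  r-1  = r + fromℚ (ℚ.- 1ℚ)
  1+r  = fromℕ 1 + r
  3+r  = fromℕ 3 + r
  2+2r = 1+r + 1+r

  0≤r-1 : fromℕ 0 ≤ r-1
  0≤r-1 = pointwise-≤ (fromℕ 0) r-1 (map (λ n (1≤r , _) → p≤q⇒0≤q-p 1≤r) 1≤r≤3)

  1+r≤4 : 1+r ≤ fromℕ 4
  1+r≤4 = pointwise-≤ 1+r (fromℕ 4) (map (λ n (_ , r≤3) → ℚ.+-monoʳ-≤ 1ℚ r≤3) 1≤r≤3)

  4≤3+r : fromℕ 4 ≤ 3+r
  4≤3+r = pointwise-≤ (fromℕ 4) 3+r (map (λ n (1≤r , _) → ℚ.+-monoʳ-≤ (+ 3 ℚ./ 1) 1≤r) 1≤r≤3)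

  -- The items 0, 1, 2 are a, b, c; an atom is given by the items covering it.
  atoms : Fin 4 → Subset 3
  atoms = lookup
    ( (inside  ∷ inside  ∷ outside ∷ [])
    ∷ (inside  ∷ outside ∷ inside  ∷ [])
    ∷ (outside ∷ inside  ∷ outside ∷ [])
    ∷ (outside ∷ outside ∷ inside  ∷ [])
    ∷ [])

  -- The two shared atoms weigh 2 each, so `a` covers 4; a private atom of weight `r - 1` brings
  -- each of `b` and `c` to `1 + r`.
  weights : Fin 4 → ℝ
  weights = lookup (fromℕ 2 ∷ fromℕ 2 ∷ r-1 ∷ r-1 ∷ [])

  weights-nonneg : ∀ j → fromℕ 0 ≤ weights j
  weights-nonneg zero                   = fromℕ-mono-≤ {0} {2} z≤n
  weights-nonneg (suc zero)             = fromℕ-mono-≤ {0} {2} z≤n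
  weights-nonneg (suc (suc zero))       = 0≤r-1
  weights-nonneg (suc (suc (suc zero))) = 0≤r-1

  f : Subset 3 → ℝ
  f = coverage atoms weights

  f-monotone : ∀ X Y → X ⊆ Y → f X ≤ f Y
  f-monotone X Y = coverage-monotone atoms weights weights-nonneg {X} {Y}

  f-∅-≈ : f ⊥ ≈ fromℕ 0
  f-∅-≈ = pointwise-≡ (f ⊥) (fromℕ 0) (λ _ → refl) , pointwise-≡ (fromℕ 0) (f ⊥) (λ _ → refl)

  instance₃ : Instance
  instance₃ = record
    { n          = 3
    ; s          = λ _ → 1
    ; s-positive = λ _ → s≤s z≤n
    ; f          = f
    ; f-nonneg   = λ X → ≤-trans (fromℕ 0) (f ⊥) (f X) (proj₂ f-∅-≈) (f-monotone ⊥ X ⊥⊆)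
    ; f-∅        = f-∅-≈
    ; monotone   = λ {X} {Y} → f-monotone X Y
    ; submodular = coverage-submodular atoms weights weights-nonneg
    }

  open Instance instance₃ using (size)

  -- Values of `f` and the optima at capacities 1 and 2.

  a b c ab ac bc : Subset 3
  a  = inside  ∷ outside ∷ outside ∷ []
  b  = outside ∷ inside  ∷ outside ∷ []
  c  = outside ∷ outside ∷ inside  ∷ []
  ab = inside  ∷ inside  ∷ outside ∷ []
  ac = inside  ∷ outside ∷ inside  ∷ []
  bc = outside ∷ inside  ∷ inside  ∷ []

  open +-*-Solver

  #_ : ∀ {k} → ℕ → Polynomial k
  # m = con (+ m ℚ./ 1)

  -- Solver counterparts of the reals of similar name, built in the same way so that they evaluate
  -- definitionally to the terms of their sequences.
  :r-1 :1+r :2+2r :4+4r :8+8r : ∀ {k} → Polynomial k → Polynomial k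
  :r-1  x = x :+ con (ℚ.- 1ℚ)
  :1+r  x = # 1 :+ x
  :2+2r x = :1+r x :+ :1+r x
  :4+4r x = :2+2r x :+ :2+2r x
  :8+8r x = :4+4r x :+ :4+4r x

  f[b] : ∀ n → seq (f b) n ≡ seq 1+r n
  -- The polynomial follows the nested sum over the atoms: `# 0` is an unmet atom, the end of the
  -- fold, or both.
  f[b] n = solve 1 (λ x → # 2 :+ (# 0 :+ (:r-1 x :+ # 0)) := :1+r x) refl (seq r n)

  f[c] : ∀ n → seq (f c) n ≡ seq 1+r n
  f[c] n = solve 1 (λ x → # 0 :+ (# 2 :+ (# 0 :+ (:r-1 x :+ # 0))) := :1+r x) refl (seq r n)

  f[ab] : ∀ n → seq (f ab) n ≡ seq 3+r n
  f[ab] n = solve 1 (λ x → # 2 :+ (# 2 :+ (:r-1 x :+ # 0)) := # 3 :+ x) refl (seq r n)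

  f[ac] : ∀ n → seq (f ac) n ≡ seq 3+r n
  f[ac] n = solve 1 (λ x → # 2 :+ (# 2 :+ (# 0 :+ (:r-1 x :+ # 0))) := # 3 :+ x) refl (seq r n)

  f[bc] : ∀ n → seq (f bc) n ≡ seq 2+2r n
  f[bc] n = solve 1 (λ x → # 2 :+ (# 2 :+ (:r-1 x :+ (:r-1 x :+ # 0))) := :2+2r x) refl (seq r n)

  -- Since `b` and `c` together meet every atom, `f ⊤` and `f bc` evaluate to the same sum.
  f≤2+2r : ∀ Y → f Y ≤ 2+2r
  f≤2+2r Y = ≤-trans (f Y) (f bc) 2+2r (f-monotone Y ⊤ ⊆⊤) (pointwise-≡ (f bc) 2+2r f[bc])

  single-≤4 : ∀ Y → size Y ℕ.≤ 1 → f Y ≤ fromℕ 4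
  single-≤4 (outside ∷ outside ∷ outside ∷ []) _ = fromℕ-mono-≤ {0} {4} z≤n
  single-≤4 (inside  ∷ outside ∷ outside ∷ []) _ = ≤-refl (fromℕ 4)
  single-≤4 (outside ∷ inside  ∷ outside ∷ []) _ =
    ≤-trans (f b) 1+r (fromℕ 4) (pointwise-≡ (f b) 1+r f[b]) 1+r≤4
  single-≤4 (outside ∷ outside ∷ inside  ∷ []) _ =
    ≤-trans (f c) 1+r (fromℕ 4) (pointwise-≡ (f c) 1+r f[c]) 1+r≤4
  single-≤4 (inside  ∷ inside  ∷ _ ∷ [])       (s≤s ())
  single-≤4 (inside  ∷ outside ∷ inside  ∷ []) (s≤s ())
  single-≤4 (outside ∷ inside  ∷ inside  ∷ []) (s≤s ())

  pair-∋a-≤3+r : ∀ Y → zero ∈ Y → size Y ℕ.≤ 2 → f Y ≤ 3+r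
  pair-∋a-≤3+r (inside ∷ outside ∷ outside ∷ []) _ _ = 4≤3+r
  pair-∋a-≤3+r (inside ∷ inside  ∷ outside ∷ []) _ _ = pointwise-≡ (f ab) 3+r f[ab]
  pair-∋a-≤3+r (inside ∷ outside ∷ inside  ∷ []) _ _ = pointwise-≡ (f ac) 3+r f[ac]
  pair-∋a-≤3+r (inside ∷ inside  ∷ inside  ∷ []) _ (s≤s (s≤s ()))

  single-≢a-≤1+r : ∀ i Y → suc i ∈ Y → size Y ℕ.≤ 1 → f Y ≤ 1+r
  single-≢a-≤1+r zero       (outside ∷ inside  ∷ outside ∷ []) _ _ = pointwise-≡ (f b) 1+r f[b]
  single-≢a-≤1+r (suc zero) (outside ∷ outside ∷ inside  ∷ []) _ _ = pointwise-≡ (f c) 1+r f[c]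
  single-≢a-≤1+r zero       (outside ∷ inside  ∷ inside  ∷ []) _ (s≤s ())
  single-≢a-≤1+r (suc zero) (outside ∷ inside  ∷ inside  ∷ []) _ (s≤s ())
  single-≢a-≤1+r zero       (inside ∷ inside ∷ _ ∷ []) _ (s≤s ())
  single-≢a-≤1+r (suc zero) (inside ∷ inside ∷ inside ∷ []) _ (s≤s ())
  single-≢a-≤1+r (suc zero) (inside ∷ outside ∷ inside ∷ []) _ (s≤s ())
  single-≢a-≤1+r zero       (_ ∷ outside ∷ _ ∷ []) (there ()) _
  single-≢a-≤1+r (suc zero) (_ ∷ _ ∷ outside ∷ []) (there (there ())) _

  opt₁ : IsOPT instance₃ (fromℕ 1) a
  opt₁ = ≤-refl (fromℕ 1) , λ Y Y≤1 → single-≤4 Y (fromℕ-cancel-≤ {size Y} {1} Y≤1)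

  opt₂ : IsOPT instance₃ (fromℕ 2) bc
  opt₂ = ≤-refl (fromℕ 2) , λ Y _ → f-monotone Y ⊤ ⊆⊤

  -- The two kinds of trees, told apart by their first item.

  Outcome : DetPolicy instance₃ → Set
  Outcome t = ∃[ Y₁ ] ∃[ Y₂ ]
    IsALG instance₃ (fromℕ 1) t Y₁ × IsALG instance₃ (fromℕ 2) t Y₂ ×
    (f Y₁ ≤ fromℕ 4 × f Y₂ ≤ 3+r ⊎ f Y₁ ≤ 1+r × f Y₂ ≤ 2+2r)

  -- The root item has size 1 and fits at both capacities. If it is `a`, capacity 2 leaves no room
  -- for both `b` and `c`; if it is `b` or `c`, it fills capacity 1 alone.
  outcome : ∀ t → Outcome t
  -- The empty output is counted with the trees that do not start with `a`.
  outcome stop = ⊥ , ⊥ , stop , stop , inj₂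
    ( ≤-trans (f ⊥) (f b) 1+r (f-monotone ⊥ b ⊥⊆) (pointwise-≡ (f b) 1+r f[b])
    , f≤2+2r ⊥ )
  outcome (try zero _ t u)
    with Y₁ , alg₁ , _   , Y₁≤1 ← run-first-fits instance₃ 1 t u (s≤s z≤n)
       | Y₂ , alg₂ , a∈Y₂ , Y₂≤2 ← run-first-fits instance₃ 2 t u (s≤s z≤n)
    = Y₁ , Y₂ , alg₁ , alg₂ , inj₁ (single-≤4 Y₁ Y₁≤1 , pair-∋a-≤3+r Y₂ a∈Y₂ Y₂≤2)
  outcome (try (suc i) _ t u)
    with Y₁ , alg₁ , i∈Y₁ , Y₁≤1 ← run-first-fits instance₃ 1 t u (s≤s z≤n)
       | Y₂ , alg₂ , _ , _ ← run-first-fits instance₃ 2 t u (s≤s z≤n)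
    = Y₁ , Y₂ , alg₁ , alg₂ , inj₂ (single-≢a-≤1+r i Y₁ i∈Y₁ Y₁≤1 , f≤2+2r Y₂)

  -- Deterministic policies.

  4+4r 8+8r 10+6r : ℝ
  4+4r  = 2+2r + 2+2r
  8+8r  = 4+4r + 4+4r
  -- This is `(5 + r)(1 + r)` with `r * r` replaced by 5; that 5 stands apart so that the two can be
  -- exchanged.
  10+6r = (fromℕ 5 + r) + (fromℕ 5 * 1+r)

  0<1+r : fromℕ 0 < 1+r
  0<1+r = 1ℚ , ℚ.positive⁻¹ 1ℚ , map (λ n (1≤r , _) → ℚ.≤-trans (ℚ.≤-reflexive (ℚ.+-comm 0ℚ 1ℚ))
    (ℚ.+-monoʳ-≤ 1ℚ (ℚ.≤-trans (ℚ.nonNegative⁻¹ 1ℚ) 1≤r))) 1≤r≤3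

  0<2+2r : fromℕ 0 < 2+2r
  0<2+2r = +-pos 1+r 1+r 0<1+r 0<1+r

  0<4+4r : fromℕ 0 < 4+4r
  0<4+4r = +-pos 2+2r 2+2r 0<2+2r 0<2+2r

  -- Since `r * r ≈ 5`, `6 + 2r` is `(1 + r)²`. Hence `3 + r` is the fraction `(1 + r) / 4` of
  -- `2 + 2r`, stated here for the doubles.
  3+r-ratio : 3+r + 3+r ≤ (1+r / 4) * 4+4r
  3+r-ratio = begin
    3+r + 3+r             ≲⟨ pointwise-≡ (3+r + 3+r) (fromℕ 5 + (r + 1+r)) (λ n → solve 1 (λ x →
                              (# 3 :+ x) :+ (# 3 :+ x) := # 5 :+ (x :+ :1+r x)) refl (seq r n)) ⟩
    fromℕ 5 + (r + 1+r)   ≲⟨ +-mono-≤ (fromℕ 5) (r * r) (r + 1+r) (r + 1+r)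
                              (proj₂ r²≈5) (≤-refl (r + 1+r)) ⟩
    r * r + (r + 1+r)     ≲⟨ pointwise-≡ (r * r + (r + 1+r)) ((1+r / 4) * 4+4r) (λ n → solve 1 (λ x →
                              x :* x :+ (x :+ :1+r x) := (:1+r x :* con (+ 1 ℚ./ 4)) :* :4+4r x)
                              refl (seq r n)) ⟩
    (1+r / 4) * 4+4r      ∎
    where open ≤-Reasoning

  -- Each kind of tree is refuted at the capacity where it loses: `1 + r` against 4 at capacity 1,
  -- or `3 + r` against `2 + 2r` at capacity 2.
  not-det-robust : ∀ α → 1+r / 4 < α → ∀ t → ¬ DetRobust instance₃ α t
  not-det-robust α γ<α t robust with Y₁ , Y₂ , alg₁ , alg₂ , bound ← outcome t with bound
  ... | inj₂ (f≤1+r , _) = <⇒*≰ (1+r / 4) α (f a) γ<α (fromℕ-mono-< {0} {4} (s≤s z≤n)) (begin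
    α * f a          ≲⟨ robust (fromℕ 1) (fromℕ-mono-≤ {0} {1} z≤n) Y₁ alg₁ a opt₁ ⟩
    f Y₁             ≲⟨ f≤1+r ⟩
    1+r              ≲⟨ pointwise-≡ 1+r ((1+r / 4) * f a) (λ n → solve 1 (λ x →
                         :1+r x := (:1+r x :* con (+ 1 ℚ./ 4)) :* # 4) refl (seq r n)) ⟩
    (1+r / 4) * f a  ∎)
    where open ≤-Reasoning
  ... | inj₁ (_ , f≤3+r) = <⇒*≰ (1+r / 4) α 4+4r γ<α 0<4+4r (begin
    -- The robustness inequality at capacity 2 is doubled to match `3+r-ratio`.
    α * 4+4r             ≲⟨ pointwise-≡ (α * 4+4r) (α * 2+2r + α * 2+2r)
                              (λ n → ℚ.*-distribˡ-+ (seq α n) (seq 2+2r n) (seq 2+2r n)) ⟩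
    α * 2+2r + α * 2+2r  ≲⟨ +-mono-≤ (α * 2+2r) 3+r (α * 2+2r) 3+r ratio ratio ⟩
    3+r + 3+r            ≲⟨ 3+r-ratio ⟩
    (1+r / 4) * 4+4r     ∎)
    where
    open ≤-Reasoning
    ratio : α * 2+2r ≤ 3+r
    ratio = begin
      α * 2+2r  ≲⟨ pointwise-≡ (α * 2+2r) (α * f bc) (λ n → cong (seq α n ℚ.*_) (sym (f[bc] n))) ⟩
      α * f bc  ≲⟨ robust (fromℕ 2) (fromℕ-mono-≤ {0} {2} z≤n) Y₂ alg₂ bc opt₂ ⟩
      f Y₂      ≲⟨ f≤3+r ⟩
      3+r       ∎

  -- Randomized policies.

  0≤1+r : fromℕ 0 ≤ 1+r
  0≤1+r = pointwise-≤ (fromℕ 0) 1+r (map (λ n (1≤r , _) →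
    ℚ.+-mono-≤ {0ℚ} {1ℚ} {0ℚ} (ℚ.nonNegative⁻¹ 1ℚ) (ℚ.≤-trans (ℚ.nonNegative⁻¹ 1ℚ) 1≤r)) 1≤r≤3)

  -- The multipliers are proportional to the reciprocals of the optima 4 and 2 + 2r,
  -- as 4 · (1 + r) = 2 · (2 + 2r).
  weighted : ∀ Y₁ Y₂ → f Y₁ ≤ fromℕ 4 × f Y₂ ≤ 3+r ⊎ f Y₁ ≤ 1+r × f Y₂ ≤ 2+2r →
             1+r * f Y₁ + fromℕ 2 * f Y₂ ≤ 10+6r
  weighted Y₁ Y₂ (inj₁ (f₁≤ , f₂≤)) = begin
    1+r * f Y₁ + fromℕ 2 * f Y₂
      ≲⟨ +-mono-≤ (1+r * f Y₁) (1+r * fromℕ 4) (fromℕ 2 * f Y₂) (fromℕ 2 * 3+r)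
           (*-monoˡ-≤-nonNeg 1+r (f Y₁) (fromℕ 4) 0≤1+r f₁≤)
           (*-monoˡ-≤-nonNeg (fromℕ 2) (f Y₂) 3+r (fromℕ-mono-≤ {0} {2} z≤n) f₂≤) ⟩
    1+r * fromℕ 4 + fromℕ 2 * 3+r
      ≲⟨ pointwise-≡ (1+r * fromℕ 4 + fromℕ 2 * 3+r) 10+6r (λ n → solve 1 (λ x →
           :1+r x :* # 4 :+ # 2 :* (# 3 :+ x) := (# 5 :+ x) :+ # 5 :* :1+r x) refl (seq r n)) ⟩
    10+6r ∎
    where
    open ≤-Reasoning
  weighted Y₁ Y₂ (inj₂ (f₁≤ , f₂≤)) = begin
    1+r * f Y₁ + fromℕ 2 * f Y₂
      ≲⟨ +-mono-≤ (1+r * f Y₁) (1+r * 1+r) (fromℕ 2 * f Y₂) (fromℕ 2 * 2+2r)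
           (*-monoˡ-≤-nonNeg 1+r (f Y₁) 1+r 0≤1+r f₁≤)
           (*-monoˡ-≤-nonNeg (fromℕ 2) (f Y₂) 2+2r (fromℕ-mono-≤ {0} {2} z≤n) f₂≤) ⟩
    1+r * 1+r + fromℕ 2 * 2+2r
      ≲⟨ pointwise-≡ (1+r * 1+r + fromℕ 2 * 2+2r) ((r * r + r) + fromℕ 5 * 1+r) (λ n →
           solve 1 (λ x → :1+r x :* :1+r x :+ # 2 :* :2+2r x := (x :* x :+ x) :+ # 5 :* :1+r x)
             refl (seq r n)) ⟩
    (r * r + r) + fromℕ 5 * 1+r
      ≲⟨ +-mono-≤ (r * r + r) (fromℕ 5 + r) (fromℕ 5 * 1+r) (fromℕ 5 * 1+r)
           (+-mono-≤ (r * r) (fromℕ 5) r r (proj₁ r²≈5) (≤-refl r)) (≤-refl (fromℕ 5 * 1+r)) ⟩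
    10+6r ∎
    where open ≤-Reasoning

  -- Exchanging 5 for `r * r` makes the left side factor as `(5 + r)(1 + r)`.
  10+6r-ratio : 10+6r ≤ ((fromℕ 5 + r) / 8) * 8+8r
  10+6r-ratio = begin
    (fromℕ 5 + r) + fromℕ 5 * 1+r
      ≲⟨ +-mono-≤ (fromℕ 5 + r) (r * r + r) (fromℕ 5 * 1+r) (fromℕ 5 * 1+r)
           (+-mono-≤ (fromℕ 5) (r * r) r r (proj₂ r²≈5) (≤-refl r)) (≤-refl (fromℕ 5 * 1+r)) ⟩
    (r * r + r) + fromℕ 5 * 1+r
      ≲⟨ pointwise-≡ ((r * r + r) + fromℕ 5 * 1+r) (((fromℕ 5 + r) / 8) * 8+8r)
           (λ n → solve 1 (λ x → (x :* x :+ x) :+ # 5 :* :1+r x :=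
             ((# 5 :+ x) :* con (+ 1 ℚ./ 8)) :* :8+8r x) refl (seq r n)) ⟩
    ((fromℕ 5 + r) / 8) * 8+8r ∎
    where open ≤-Reasoning

  -- An averaging argument: the robustness inequalities at capacities 1 and 2 are added with
  -- multipliers `1 + r` and 2. The right side becomes the expectation of `v`, which `weighted`
  -- bounds for each tree separately.
  not-rand-robust : ∀ α → (fromℕ 5 + r) / 8 < α → ∀ π → ¬ RandRobust instance₃ α π
  not-rand-robust α γ<α π robust =
    <⇒*≰ ((fromℕ 5 + r) / 8) α 8+8r γ<α (+-pos 4+4r 4+4r 0<4+4r 0<4+4r) (begin
      α * 8+8r
        -- The optima 4 and `2 + 2r` contribute `4 + 4r` each after multiplication.
        ≲⟨ pointwise-≡ (α * 8+8r) (1+r * (α * f a) + fromℕ 2 * (α * 2+2r))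
             (λ n → solve 2 (λ α x → α :* :8+8r x := :1+r x :* (α :* # 4) :+ # 2 :* (α :* :2+2r x))
               refl (seq α n) (seq r n)) ⟩
      1+r * (α * f a) + fromℕ 2 * (α * 2+2r)
        ≲⟨ pointwise-≡ (1+r * (α * f a) + fromℕ 2 * (α * 2+2r)) (1+r * (α * f a) + fromℕ 2 * (α * f bc))
             (λ n → cong (λ v → seq (1+r * (α * f a)) n ℚ.+ seq (fromℕ 2) n ℚ.* (seq α n ℚ.* v))
               (sym (f[bc] n))) ⟩
      1+r * (α * f a) + fromℕ 2 * (α * f bc)
        ≲⟨ +-mono-≤ (1+r * (α * f a)) (1+r * 𝔼₁) (fromℕ 2 * (α * f bc)) (fromℕ 2 * 𝔼₂)
             (*-monoˡ-≤-nonNeg 1+r (α * f a) 𝔼₁ 0≤1+r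
               (robust (fromℕ 1) (fromℕ-mono-≤ {0} {1} z≤n) Y₁
                 (λ j → proj₁ (proj₂ (proj₂ (outcome (tree j))))) a opt₁))
             (*-monoˡ-≤-nonNeg (fromℕ 2) (α * f bc) 𝔼₂ (fromℕ-mono-≤ {0} {2} z≤n)
               (robust (fromℕ 2) (fromℕ-mono-≤ {0} {2} z≤n) Y₂
                 (λ j → proj₁ (proj₂ (proj₂ (proj₂ (outcome (tree j)))))) bc opt₂)) ⟩
      1+r * 𝔼₁ + fromℕ 2 * 𝔼₂
        ≲⟨ pointwise-≡ (1+r * 𝔼₁ + fromℕ 2 * 𝔼₂) (∑ λ j → p j * v j)
             (∑-linear 1+r (fromℕ 2) p (λ j → f (Y₁ j)) (λ j → f (Y₂ j))) ⟩
      (∑ λ j → p j * v j)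
        ≲⟨ mean-≤ p v 10+6r p-nonneg p-total 0≤10+6r
             (λ j → weighted (Y₁ j) (Y₂ j) (proj₂ (proj₂ (proj₂ (proj₂ (outcome (tree j))))))) ⟩
      10+6r
        ≲⟨ 10+6r-ratio ⟩
      ((fromℕ 5 + r) / 8) * 8+8r ∎)
    where
    open ≤-Reasoning
    open RandPolicy π
    Y₁ Y₂ : Fin k → Subset 3
    Y₁ j = proj₁ (outcome (tree j))
    Y₂ j = proj₁ (proj₂ (outcome (tree j)))
    𝔼₁ 𝔼₂ : ℝ
    𝔼₁ = ∑ λ j → p j * f (Y₁ j)
    𝔼₂ = ∑ λ j → p j * f (Y₂ j)
    v : Fin k → ℝ
    v j = 1+r * f (Y₁ j) + fromℕ 2 * f (Y₂ j)
    0≤10+6r : fromℕ 0 ≤ 10+6r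
    0≤10+6r = pointwise-≤ (fromℕ 0) 10+6r (map (λ n (1≤r , _) →
      let 0≤x = ℚ.≤-trans (ℚ.nonNegative⁻¹ 1ℚ) 1≤r
          0≤5 = ℚ.nonNegative⁻¹ (+ 5 ℚ./ 1)
      in +-nonneg (+-nonneg 0≤5 0≤x) (*-nonneg 0≤5 (+-nonneg (ℚ.nonNegative⁻¹ 1ℚ) 0≤x))) 1≤r≤3)

theorem7 : ((α : ℝ) → (fromℕ 1 + √ 5) / 4 < α →
    Σ[ I ∈ Instance ] UnitSizes I × ((π : DetPolicy I) → ¬ DetRobust I α π))
    ×
    ((α : ℝ) → (fromℕ 5 + √ 5) / 8 < α →
    Σ[ I ∈ Instance ] UnitSizes I × ((π : RandPolicy I) → ¬ RandRobust I α π))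
theorem7 =
  (λ α γ<α → instance₃ , (λ _ → refl) , not-det-robust α γ<α) ,
  (λ α γ<α → instance₃ , (λ _ → refl) , not-rand-robust α γ<α)
  where open GoldenInstance (√ 5) (√-nonneg 5) (√-square 5)
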